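{- A circuit is erasable if and only if it is sequentializable. In particular, the circuit translation of every MALL proof is erasable.
   Context: Fix literals with an involution $a\mapsto\bar a$ ($\bar a\ne a$, $\bar{\bar a}=a$); MALL formulas are built from literals by $\otimes,⅋,\&,\oplus$; sequents are finite lists of formulas. MALL proofs use the rules: axiom $\vdash P,\bar P$ ($P$ a literal); permutation (from $A_1,\dots,A_n$ infer $A_{\sigma1},\dots,A_{\sigma n}$); $⅋$ (from $\Gamma,A,B$ infer $\Gamma,A⅋B$); $\oplus_i$, $i\in\{0,1\}$ (from $\Gamma,A_i$ infer $\Gamma,A_0\oplus A_1$); $\otimes$ (from $\Gamma,A$ and $B,\Delta$ infer $\Gamma,A\otimes B,\Delta$); $\&$ (from $\Gamma,A$ and $\Gamma,B$ infer $\Gamma,A\&B$). A circuit consists of a finite non-empty set of nodes and a finite set of wires; each wire is labelled by a formula, has a source node and possibly a target node distinct from the source; a wire with no target is an exit. Each node is of one of the kinds: axiom (source of two wires labelled by dual literals, target of none); contraction (target of two wires, source of one, all three with the same formula); binary of type $\otimes$, $⅋$ or $\&$ (target of a designated left wire labelled $A$ and right wire labelled $B$, source of one wire labelled $A\square B$ where $\square$ is its type); plus (target of one wire designated left or right, labelled $A$, source of one wire labelled $A\oplus B$ if left, $B\oplus A$ if right, for some $B$). The underlying undirected graph (nodes joined by wires) is connected, and the exits are linearly ordered; the list of exit formulas is the conclusion. A node is final if it is the source of an exit. A node $N$ is ready if it is final and: $N$ is a plus node; or $N$ is a $\otimes$ node and deleting $N$ (with its exit) leaves exactly two connected components; or $N$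 is a $⅋$ node and deleting $N$ leaves the circuit connected; or $N$ is a $\&$ node, every other final node is a contraction node, deleting all final nodes with their exits leaves exactly two connected components $X_1,X_2$, and every final node has one incoming wire in $X_1$ and the other in $X_2$; or $N$ is an axiom node and the only node. Deleting a node turns its incoming wires into exits. For ready $N$, $X\leadsto_N S$ where $S$ is the set of connected components obtained by deleting $N$ (in the $\&$ case: deleting all final nodes, giving $\{X_1,X_2\}$; in the axiom case $S=\emptyset$), each made into a circuit with an exit order induced from that of $X$. For finite sets of circuits, $T\leadsto U$ if $T=T'\cup\{X\}$ (disjoint), $X\leadsto_N S$ for some ready $N$, and $U=T'\cup S$. A circuit $X$ is erasable if $\{X\}\leadsto^*\emptyset$. Translation of a proof to a circuit, by induction: axiom $\vdash P,\bar P$ gives one axiom node with exits $P,\bar P$ in that order; permutation $\sigma$ permutes the exit order; $⅋$ adds a $⅋$ node targeted by the last two exits (the last one right), with new exit $A⅋B$ placed last; $\oplus_i$ adds a plus node targeted by the last exit (designated left if $i=0$, right if $i=1$), new exit $A_0\oplus A_1$ placed last; $\otimes$ takes the disjoint union of the two premise circuits, adds a $\otimes$ node targeted by the last exit of the first (left) and first exit of the second (right), with exit order: remaining exits of the first, then the new exit $A\otimes B$, then remaining exits of the second; $\&$ (premises $B_1,\dots,B_n,A_i$) takes the disjoint union, adds a $\&$ node targeted by the last exits (left from the first premise), and for each $j\le n$ a contraction node targeted by the $j$-th exits of both, with new exits ordered $B_1,\dots,B_n,A_0\&A_1$. A circuit is sequentializable if it is (isomorphic to) the translation of some proof. -}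

module Defs where

open import Data.Fin.Base using (Fin; zero; suc)
import Data.Fin.Properties as Fin
open import Data.List.Base using (List; []; _∷_; _++_; map; concatMap; zipWith; length; lookup; allFin; tabulate)
open import Data.List.Properties using (map-++; ++-identityʳ; map-∘; ++-assoc; ∷-injectiveˡ; ∷-injectiveʳ; map-tabulate; tabulate-lookup)
open import Data.List.Membership.Propositional using (_∈_; _∉_)
import Data.List.Membership.DecPropositional as DecMembership
open import Data.List.Membership.Propositional.Properties using (∈-map⁺; ∈-map⁻; ∈-++⁺ˡ; ∈-++⁺ʳ; ∈-++⁻; ∈-allFin; ∈-lookup)
open import Data.List.Relation.Unary.All as All using (All; []; _∷_)
import Data.List.Relation.Unary.All.Properties as All
open import Data.List.Relation.Unary.Any using (Any; here; there; index)
open import Data.List.Relation.Unary.Any.Properties using (lookup-index)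
open import Data.List.Relation.Unary.AllPairs using (AllPairs; []; _∷_)
open import Data.List.Relation.Unary.Unique.Propositional using (Unique)
import Data.List.Relation.Unary.Unique.Propositional.Properties as Unique
open import Data.List.Relation.Binary.Pointwise using (Pointwise)
open import Data.List.Relation.Binary.Permutation.Propositional using (_↭_; ↭-refl; ↭-sym; ↭-trans; prep; ↭-reflexive; ↭⇒↭ₛ; module PermutationReasoning)
open import Data.List.Relation.Binary.Permutation.Propositional.Properties using (↭-map-inv; ∈-resp-↭; shift; ++-comm; ++⁺ˡ)
import Data.List.Relation.Binary.Permutation.Setoid.Properties as PermutationSetoid
open import Data.List.Relation.Binary.Sublist.Propositional using (_⊆_)
open import Data.Maybe.Base as Maybe using (Maybe; just; nothing)
open import Data.Nat.Base using (_+_)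
open import Data.Product.Base using (Σ-syntax; ∃; ∃₂; ∃-syntax; _×_; _,_; proj₂)
open import Data.Sum.Base using (_⊎_; inj₁; inj₂; [_,_]′)
open import Data.Sum.Properties using (inj₁-injective; inj₂-injective)
open import Data.Sum.Function.Propositional using (_⊎-↔_)
open import Data.Unit.Base using (⊤; tt)
open import Function.Base using (_∘_; id)
open import Function.Bundles using (_⇔_; mk⇔; _↔_; Inverse; Equivalence)
open import Function.Definitions using (Injective)
open import Function.Properties.Inverse using (↔-refl; ↔-sym; ↔-trans; Inverse⇒Injection)
open import Relation.Binary.Construct.Closure.Equivalence using (EqClosure; return; symmetric; gmap)
open import Relation.Binary.Construct.Closure.ReflexiveTransitive using (Star; ε; _◅◅_)
open import Relation.Binary.Definitions using (DecidableEquality)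
open import Relation.Binary.PropositionalEquality using (_≡_; _≢_; refl; sym; trans; cong; cong₂; subst; setoid; module ≡-Reasoning)
open import Relation.Nullary using (¬_; Dec; yes; no; contradiction)

record Literals : Set₁ where
  field
    Literal          : Set
    dual             : Literal → Literal
    dual-irreflexive : ∀ a → dual a ≢ a
    dual-involutive  : ∀ a → dual (dual a) ≡ a

Finite : Set → Set
Finite A = ∃[ n ] (A ↔ Fin n)

finite-≟ : ∀ {A} → Finite A → DecidableEquality A
finite-≟ (_ , A↔Fin) = Fin.inj⇒≟ (Inverse⇒Injection A↔Fin)

⊎-finite : ∀ {A B} → Finite A → Finite B → Finite (A ⊎ B)
⊎-finite (m , A↔) (n , B↔) = m + n , ↔-trans (A↔ ⊎-↔ B↔) (↔-sym Fin.+↔⊎)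

data Side : Set where
  left right : Side

data BinaryType : Set where
  tensor par with′ : BinaryType

-- The left and right wires of a binary node are designated in its kind; the
-- two incoming wires of a contraction node are not distinguished.
data Kind (W : Set) : Set where
  axiom       : Kind W
  contraction : Kind W
  binary      : BinaryType → (l r : W) → Kind W
  plus        : Side → Kind W

mapKind : ∀ {V W} → (V → W) → Kind V → Kind W
mapKind f axiom          = axiom
mapKind f contraction    = contraction
mapKind f (binary □ l r) = binary □ (f l) (f r)
mapKind f (plus s)       = plus s

unmap-++ : ∀ {A B : Set} (f : A → B) ws {xs ys} → map f ws ≡ xs ++ ys →
           ∃₂ λ us vs → ws ≡ us ++ vs × map f us ≡ xs × map f vs ≡ ys
unmap-++ f ws       {[]}     eq = [] , ws , refl , refl , eq
unmap-++ f (w ∷ ws) {x ∷ xs} eq with unmap-++ f ws {xs} (∷-injectiveʳ eq)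
... | us , vs , refl , p , q = w ∷ us , vs , refl , cong₂ _∷_ (∷-injectiveˡ eq) p , q

module _ {A : Set} where

  Unique-++ˡ : ∀ (xs : List A) {ys} → Unique (xs ++ ys) → Unique xs
  Unique-++ˡ []       u       = []
  Unique-++ˡ (x ∷ xs) (p ∷ u) = All.++⁻ˡ xs p ∷ Unique-++ˡ xs u

  Unique-++ʳ : ∀ (xs : List A) {ys} → Unique (xs ++ ys) → Unique ys
  Unique-++ʳ []       u       = u
  Unique-++ʳ (x ∷ xs) (p ∷ u) = Unique-++ʳ xs u

  Unique-++-disjoint : ∀ (xs : List A) {ys w} → Unique (xs ++ ys) → w ∈ xs → w ∉ ys
  Unique-++-disjoint (x ∷ xs) (p ∷ u) (here refl) q = All.lookup (All.++⁻ʳ xs p) q refl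
  Unique-++-disjoint (x ∷ xs) (p ∷ u) (there r)   q = Unique-++-disjoint xs u r q

module MALL (L : Literals) where

  open Literals L

  infixr 7 _⊗_ _⅋_ _&_ _⊕_

  data Formula : Set where
    lit             : Literal → Formula
    _⊗_ _⅋_ _&_ _⊕_ : Formula → Formula → Formula

  Sequent : Set
  Sequent = List Formula

  connective : BinaryType → Formula → Formula → Formula
  connective tensor = _⊗_
  connective par    = _⅋_
  connective with′  = _&_

  -- plusFormula s A B is A ⊕ B with A on side s.
  plusFormula : Side → Formula → Formula → Formula
  plusFormula left  A B = A ⊕ B
  plusFormula right A B = B ⊕ A

  infix 3 ⊢_

  data ⊢_ : Sequent → Set where
    axiom  : ∀ P → ⊢ lit P ∷ lit (dual P) ∷ []
    perm   : ∀ {Γ Δ} → Γ ↭ Δ → ⊢ Γ → ⊢ Δ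
    par    : ∀ Γ {A B} → ⊢ Γ ++ A ∷ B ∷ [] → ⊢ Γ ++ A ⅋ B ∷ []
    plus   : ∀ Γ s {A} B → ⊢ Γ ++ A ∷ [] → ⊢ Γ ++ plusFormula s A B ∷ []
    tensor : ∀ Γ Δ {A B} → ⊢ Γ ++ A ∷ [] → ⊢ B ∷ Δ → ⊢ Γ ++ A ⊗ B ∷ Δ
    with′  : ∀ Γ {A B} → ⊢ Γ ++ A ∷ [] → ⊢ Γ ++ B ∷ [] → ⊢ Γ ++ A & B ∷ []

  module _ {Node Wire : Set} (src : Wire → Node) (tgt : Wire → Maybe Node) (label : Wire → Formula) where

    Incoming Outgoing : Node → List Wire → Set
    Incoming v ws = ∀ w → tgt w ≡ just v ⇔ w ∈ ws
    Outgoing v ws = ∀ w → src w ≡ v ⇔ w ∈ ws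

    data WellFormed (v : Node) : Kind Wire → Set where
      axiom : ∀ P a b → a ≢ b →
              Incoming v [] → Outgoing v (a ∷ b ∷ []) →
              label a ≡ lit P → label b ≡ lit (dual P) →
              WellFormed v axiom
      contraction : ∀ a b c → a ≢ b →
              Incoming v (a ∷ b ∷ []) → Outgoing v (c ∷ []) →
              label a ≡ label c → label b ≡ label c →
              WellFormed v contraction
      binary : ∀ □ l r c → l ≢ r →
              Incoming v (l ∷ r ∷ []) → Outgoing v (c ∷ []) →
              label c ≡ connective □ (label l) (label r) →
              WellFormed v (binary □ l r)
      plus : ∀ s a c B →
              Incoming v (a ∷ []) → Outgoing v (c ∷ []) →
              label c ≡ plusFormula s (label a) B →
              WellFormed v (plus s)

    inputs : ∀ {v k} → WellFormed v k → List Wire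
    inputs (axiom _ _ _ _ _ _ _ _)       = []
    inputs (contraction a b _ _ _ _ _ _) = a ∷ b ∷ []
    inputs (binary _ l r _ _ _ _ _)      = l ∷ r ∷ []
    inputs (plus _ a _ _ _ _ _)          = a ∷ []

  -- A circuit without the requirements of being non-empty and connected.
  record PreCircuit : Set₁ where
    field
      Node Wire      : Set
      node-finite    : Finite Node
      wire-finite    : Finite Wire
      kind           : Node → Kind Wire
      src            : Wire → Node
      tgt            : Wire → Maybe Node
      label          : Wire → Formula
      tgt≢src        : ∀ w → tgt w ≢ just (src w)
      wellFormed     : ∀ v → WellFormed src tgt label v (kind v)
      exits          : List Wire
      exits-unique   : Unique exits
      exits-complete : ∀ w → w ∈ exits ⇔ tgt w ≡ nothing

    conclusion : Sequent
    conclusion = map label exits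

    _≟ᴺ_ : DecidableEquality Node
    _≟ᴺ_ = finite-≟ node-finite

    _≟ᵂ_ : DecidableEquality Wire
    _≟ᵂ_ = finite-≟ wire-finite

    incoming : Node → List Wire
    incoming v = inputs src tgt label (wellFormed v)

    Joined : Node → Node → Set
    Joined u v = ∃[ w ] (src w ≡ u × tgt w ≡ just v)

    Connected : Node → Node → Set
    Connected = EqClosure Joined

  record Circuit : Set₁ where
    field
      preCircuit : PreCircuit
    open PreCircuit preCircuit public
    field
      nonEmpty  : Node
      connected : ∀ u v → Connected u v

  -- Isomorphisms preserve left/right designations (through kind) and the exit
  -- order, but may exchange the two incoming wires of a contraction node.
  record _≅_ (X Y : Circuit) : Set where
    private
      module X = Circuit X
      module Y = Circuit Y
    field
      nodes : X.Node ↔ Y.Node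
      wires : X.Wire ↔ Y.Wire
    node : X.Node → Y.Node
    node = Inverse.to nodes
    wire : X.Wire → Y.Wire
    wire = Inverse.to wires
    field
      kind-≡  : ∀ v → Y.kind (node v) ≡ mapKind wire (X.kind v)
      src-≡   : ∀ w → Y.src (wire w) ≡ node (X.src w)
      tgt-≡   : ∀ w → Y.tgt (wire w) ≡ Maybe.map node (X.tgt w)
      label-≡ : ∀ w → Y.label (wire w) ≡ X.label w
      exits-≡ : Y.exits ≡ map wire X.exits

  module Erasure (X : Circuit) where

    open Circuit X

    Final : Node → Set
    Final v = ∃[ w ] (src w ≡ v × tgt w ≡ nothing)

    finals : List Node
    finals = map src exits

    -- Connectedness in the graph obtained from X by deleting the nodes ds.
    ConnectedWithout : List Node → Node → Node → Set
    ConnectedWithout ds = EqClosure (λ u v → Joined u v × u ∉ ds × v ∉ ds)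

    -- rs contains exactly one node of each connected component left after
    -- deleting ds; a component is given by such a representative.
    record Components (ds rs : List Node) : Set where
      field
        surviving : All (_∉ ds) rs
        distinct  : AllPairs (λ r s → ¬ ConnectedWithout ds r s) rs
        covering  : ∀ v → v ∉ ds → Any (λ r → ConnectedWithout ds r v) rs

    data Ready (N : Node) : Set where
      plus   : ∀ s → Final N → kind N ≡ plus s → Ready N
      tensor : ∀ l r → Final N → kind N ≡ binary tensor l r →
               ∀ x₁ x₂ → Components (N ∷ []) (x₁ ∷ x₂ ∷ []) → Ready N
      par    : ∀ l r → Final N → kind N ≡ binary par l r →
               ∀ x → Components (N ∷ []) (x ∷ []) → Ready N
      with′  : ∀ l r → Final N → kind N ≡ binary with′ l r →
               (∀ M → Final M → M ≢ N → kind M ≡ contraction) →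
               ∀ x₁ x₂ → Components finals (x₁ ∷ x₂ ∷ []) →
               (∀ M → Final M → ∃₂ λ w₁ w₂ → tgt w₁ ≡ just M × tgt w₂ ≡ just M ×
                  ConnectedWithout finals x₁ (src w₁) × ConnectedWithout finals x₂ (src w₂)) →
               Ready N
      axiom  : Final N → kind N ≡ axiom → (∀ M → M ≡ N) → Ready N

    deleted : ∀ {N} → Ready N → List Node
    deleted {N} (plus _ _ _)              = N ∷ []
    deleted {N} (tensor _ _ _ _ _ _ _)    = N ∷ []
    deleted {N} (par _ _ _ _ _ _)         = N ∷ []
    deleted     (with′ _ _ _ _ _ _ _ _ _) = finals
    deleted {N} (axiom _ _ _)             = N ∷ []

    -- The exits after deleting ds: an exit of a deleted node is replaced, in
    -- place, by the incoming wires of that node (left before right).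
    replaceExit : List Node → Wire → List Wire
    replaceExit ds e with DecMembership._∈?_ _≟ᴺ_ (src e) ds
    ... | yes _ = incoming (src e)
    ... | no  _ = e ∷ []

    residualExits : List Node → List Wire
    residualExits ds = concatMap (replaceExit ds) exits

    -- Y is, up to renaming of its nodes and wires, the component of r left
    -- after deleting ds. Since the nodes of ds are outside the image of node,
    -- tgt-⇔ makes the wires which had a target in ds exits of Y.
    record IsComponent (ds : List Node) (r : Node) (Y : Circuit) : Set where
      private
        module Y = Circuit Y
      field
        node           : Y.Node → Node
        wire           : Y.Wire → Wire
        node-injective : Injective _≡_ _≡_ node
        wire-injective : Injective _≡_ _≡_ wire
        node-image     : ∀ v → (∃[ v′ ] node v′ ≡ v) ⇔ ConnectedWithout ds r v
        wire-image     : ∀ w → (∃[ w′ ] wire w′ ≡ w) ⇔ ConnectedWithout ds r (src w)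
        kind-≡         : ∀ v → kind (node v) ≡ mapKind wire (Y.kind v)
        src-≡          : ∀ w → src (wire w) ≡ node (Y.src w)
        tgt-⇔          : ∀ w v → Y.tgt w ≡ just v ⇔ tgt (wire w) ≡ just (node v)
        label-≡        : ∀ w → label (wire w) ≡ Y.label w
        exits-⊆        : map wire Y.exits ⊆ residualExits ds

  infix 4 _⤳[_]_ _⤳_ _⤳*_

  record _⤳[_]_ (X : Circuit) (N : Circuit.Node X) (S : List Circuit) : Set₁ where
    open Erasure X
    field
      ready           : Ready N
      representatives : List (Circuit.Node X)
      components      : Components (deleted ready) representatives
      residuals       : Pointwise (IsComponent (deleted ready)) representatives S

  -- Finite sets of circuits are lists up to permutation.
  data _⤳_ (T U : List Circuit) : Set₁ where
    step : ∀ {T′ X N S} → T ↭ X ∷ T′ → X ⤳[ N ] S → U ↭ T′ ++ S → T ⤳ U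

  _⤳*_ : List Circuit → List Circuit → Set₁
  _⤳*_ = Star _⤳_

  Erasable : Circuit → Set₁
  Erasable X = X ∷ [] ⤳* []

  _⊎ᴾ_ : PreCircuit → PreCircuit → PreCircuit
  X ⊎ᴾ Y = record
    { Node           = X.Node ⊎ Y.Node
    ; Wire           = X.Wire ⊎ Y.Wire
    ; node-finite    = ⊎-finite X.node-finite Y.node-finite
    ; wire-finite    = ⊎-finite X.wire-finite Y.wire-finite
    ; kind           = [ mapKind inj₁ ∘ X.kind , mapKind inj₂ ∘ Y.kind ]′
    ; src            = src
    ; tgt            = tgt
    ; label          = label
    ; tgt≢src        = tgt≢src
    ; wellFormed     = wellFormed
    ; exits          = exits
    ; exits-unique   = Unique.++⁺ (Unique.map⁺ inj₁-injective X.exits-unique)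
                                  (Unique.map⁺ inj₂-injective Y.exits-unique) disjoint
    ; exits-complete = λ w → mk⇔ (complete⁺ w) (complete⁻ w)
    }
    where
    module X = PreCircuit X
    module Y = PreCircuit Y

    src : X.Wire ⊎ Y.Wire → X.Node ⊎ Y.Node
    src (inj₁ w) = inj₁ (X.src w)
    src (inj₂ w) = inj₂ (Y.src w)

    tgt : X.Wire ⊎ Y.Wire → Maybe (X.Node ⊎ Y.Node)
    tgt (inj₁ w) = Maybe.map inj₁ (X.tgt w)
    tgt (inj₂ w) = Maybe.map inj₂ (Y.tgt w)

    label : X.Wire ⊎ Y.Wire → Formula
    label = [ X.label , Y.label ]′

    exits : List (X.Wire ⊎ Y.Wire)
    exits = map inj₁ X.exits ++ map inj₂ Y.exits

    tgt≢src : ∀ w → tgt w ≢ just (src w)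
    tgt≢src (inj₁ w) eq with X.tgt w in eq′
    tgt≢src (inj₁ w) refl | just _ = X.tgt≢src w eq′
    tgt≢src (inj₂ w) eq with Y.tgt w in eq′
    tgt≢src (inj₂ w) refl | just _ = Y.tgt≢src w eq′

    disjoint : ∀ {w} → ¬ (w ∈ map inj₁ X.exits × w ∈ map inj₂ Y.exits)
    disjoint (p , q) with ∈-map⁻ inj₁ p | ∈-map⁻ inj₂ q
    ... | _ , _ , refl | _ , _ , ()

    complete⁺ : ∀ w → w ∈ exits → tgt w ≡ nothing
    complete⁺ w p with ∈-++⁻ (map inj₁ X.exits) p
    ... | inj₁ q with _ , r , refl ← ∈-map⁻ inj₁ q = cong (Maybe.map inj₁) (Equivalence.to (X.exits-complete _) r)
    ... | inj₂ q with _ , r , refl ← ∈-map⁻ inj₂ q = cong (Maybe.map inj₂) (Equivalence.to (Y.exits-complete _) r)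

    complete⁻ : ∀ w → tgt w ≡ nothing → w ∈ exits
    complete⁻ (inj₁ w) eq with X.tgt w in eq′
    ... | nothing = ∈-++⁺ˡ (∈-map⁺ inj₁ (Equivalence.from (X.exits-complete w) eq′))
    complete⁻ (inj₂ w) eq with Y.tgt w in eq′
    ... | nothing = ∈-++⁺ʳ _ (∈-map⁺ inj₂ (Equivalence.from (Y.exits-complete w) eq′))

    inc₁ : ∀ {v ws} → Incoming X.src X.tgt X.label v ws → Incoming src tgt label (inj₁ v) (map inj₁ ws)
    inc₁ {v} {ws} inc w = mk⇔ (to w) from
      where
      to : ∀ w → tgt w ≡ just (inj₁ v) → w ∈ map inj₁ ws
      to (inj₁ w) eq with X.tgt w in eq′
      to (inj₁ w) refl | just _ = ∈-map⁺ inj₁ (Equivalence.to (inc w) eq′)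
      to (inj₂ w) eq with Y.tgt w
      to (inj₂ w) () | just _
      to (inj₂ w) () | nothing
      from : ∀ {w} → w ∈ map inj₁ ws → tgt w ≡ just (inj₁ v)
      from p with _ , q , refl ← ∈-map⁻ inj₁ p = cong (Maybe.map inj₁) (Equivalence.from (inc _) q)

    inc₂ : ∀ {v ws} → Incoming Y.src Y.tgt Y.label v ws → Incoming src tgt label (inj₂ v) (map inj₂ ws)
    inc₂ {v} {ws} inc w = mk⇔ (to w) from
      where
      to : ∀ w → tgt w ≡ just (inj₂ v) → w ∈ map inj₂ ws
      to (inj₂ w) eq with Y.tgt w in eq′
      to (inj₂ w) refl | just _ = ∈-map⁺ inj₂ (Equivalence.to (inc w) eq′)
      to (inj₁ w) eq with X.tgt w
      to (inj₁ w) () | just _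
      to (inj₁ w) () | nothing
      from : ∀ {w} → w ∈ map inj₂ ws → tgt w ≡ just (inj₂ v)
      from p with _ , q , refl ← ∈-map⁻ inj₂ p = cong (Maybe.map inj₂) (Equivalence.from (inc _) q)

    out₁ : ∀ {v ws} → Outgoing X.src X.tgt X.label v ws → Outgoing src tgt label (inj₁ v) (map inj₁ ws)
    out₁ {v} {ws} out w = mk⇔ (to w) from
      where
      to : ∀ w → src w ≡ inj₁ v → w ∈ map inj₁ ws
      to (inj₁ w) refl = ∈-map⁺ inj₁ (Equivalence.to (out w) refl)
      from : ∀ {w} → w ∈ map inj₁ ws → src w ≡ inj₁ v
      from p with _ , q , refl ← ∈-map⁻ inj₁ p = cong inj₁ (Equivalence.from (out _) q)

    out₂ : ∀ {v ws} → Outgoing Y.src Y.tgt Y.label v ws → Outgoing src tgt label (inj₂ v) (map inj₂ ws)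
    out₂ {v} {ws} out w = mk⇔ (to w) from
      where
      to : ∀ w → src w ≡ inj₂ v → w ∈ map inj₂ ws
      to (inj₂ w) refl = ∈-map⁺ inj₂ (Equivalence.to (out w) refl)
      from : ∀ {w} → w ∈ map inj₂ ws → src w ≡ inj₂ v
      from p with _ , q , refl ← ∈-map⁻ inj₂ p = cong inj₂ (Equivalence.from (out _) q)

    wellFormed : ∀ v → WellFormed src tgt label v ([ mapKind inj₁ ∘ X.kind , mapKind inj₂ ∘ Y.kind ]′ v)
    wellFormed (inj₁ v) with X.kind v | X.wellFormed v
    ... | _ | axiom P a b a≢b i o p q       = axiom P (inj₁ a) (inj₁ b) (a≢b ∘ inj₁-injective) (inc₁ i) (out₁ o) p q
    ... | _ | contraction a b c a≢b i o p q = contraction (inj₁ a) (inj₁ b) (inj₁ c) (a≢b ∘ inj₁-injective) (inc₁ i) (out₁ o) p q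
    ... | _ | binary □ l r c l≢r i o p      = binary □ (inj₁ l) (inj₁ r) (inj₁ c) (l≢r ∘ inj₁-injective) (inc₁ i) (out₁ o) p
    ... | _ | plus s a c B i o p            = plus s (inj₁ a) (inj₁ c) B (inc₁ i) (out₁ o) p
    wellFormed (inj₂ v) with Y.kind v | Y.wellFormed v
    ... | _ | axiom P a b a≢b i o p q       = axiom P (inj₂ a) (inj₂ b) (a≢b ∘ inj₂-injective) (inc₂ i) (out₂ o) p q
    ... | _ | contraction a b c a≢b i o p q = contraction (inj₂ a) (inj₂ b) (inj₂ c) (a≢b ∘ inj₂-injective) (inc₂ i) (out₂ o) p q
    ... | _ | binary □ l r c l≢r i o p      = binary □ (inj₂ l) (inj₂ r) (inj₂ c) (l≢r ∘ inj₂-injective) (inc₂ i) (out₂ o) p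
    ... | _ | plus s a c B i o p            = plus s (inj₂ a) (inj₂ c) B (inc₂ i) (out₂ o) p

  -- A non-axiom node to be added below wires of type W; its own outgoing wire
  -- is new. In plus s a B, the formula B is the other disjunct.
  data NewNode (W : Set) : Set where
    contraction : (a b : W) → NewNode W
    binary      : BinaryType → (l r : W) → NewNode W
    plus        : Side → (a : W) → (B : Formula) → NewNode W

  newInputs : ∀ {W} → NewNode W → List W
  newInputs (contraction a b) = a ∷ b ∷ []
  newInputs (binary □ l r)    = l ∷ r ∷ []
  newInputs (plus s a B)      = a ∷ []

  newKind : ∀ {V W} → (V → W) → NewNode V → Kind W
  newKind f (contraction a b) = contraction
  newKind f (binary □ l r)    = binary □ (f l) (f r)
  newKind f (plus s a B)      = plus s

  module _ {W : Set} (label : W → Formula) where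

    newLabel : NewNode W → Formula
    newLabel (contraction a b) = label a
    newLabel (binary □ l r)    = connective □ (label l) (label r)
    newLabel (plus s a B)      = plusFormula s (label a) B

    Consistent : NewNode W → Set
    Consistent (contraction a b) = label b ≡ label a
    Consistent (binary □ l r)    = ⊤
    Consistent (plus s a B)      = ⊤

  -- Adds the nodes new to X, whose exits are split into the wires rest, which
  -- remain exits, and the incoming wires of the new nodes. The exit order of
  -- the result is es.
  module Attach
    (X : PreCircuit)
    (new : List (NewNode (PreCircuit.Wire X))) (consistent : All (Consistent (PreCircuit.label X)) new)
    (rest : List (PreCircuit.Wire X)) (split : PreCircuit.exits X ↭ rest ++ concatMap newInputs new)
    (es : List (PreCircuit.Wire X ⊎ Fin (length new))) (order : es ↭ map inj₁ rest ++ map inj₂ (allFin (length new)))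
    where

    private
      module X = PreCircuit X

    New : Set
    New = Fin (length new)

    ins : New → List X.Wire
    ins i = newInputs (lookup new i)

    consumer : ∀ w → Dec (∃[ i ] w ∈ ins i)
    consumer w = Fin.any? (λ i → DecMembership._∈?_ X._≟ᵂ_ w (ins i))

    kind : X.Node ⊎ New → Kind (X.Wire ⊎ New)
    kind (inj₁ v) = mapKind inj₁ (X.kind v)
    kind (inj₂ i) = newKind inj₁ (lookup new i)

    src : X.Wire ⊎ New → X.Node ⊎ New
    src (inj₁ w) = inj₁ (X.src w)
    src (inj₂ i) = inj₂ i

    tgt : X.Wire ⊎ New → Maybe (X.Node ⊎ New)
    tgt (inj₁ w) with consumer w
    ... | yes (i , _) = just (inj₂ i)
    ... | no  _       = Maybe.map inj₁ (X.tgt w)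
    tgt (inj₂ i) = nothing

    label : X.Wire ⊎ New → Formula
    label (inj₁ w) = X.label w
    label (inj₂ i) = newLabel X.label (lookup new i)

    ins⊆ : ∀ {w} (ns : List (NewNode X.Wire)) i → w ∈ newInputs (lookup ns i) → w ∈ concatMap newInputs ns
    ins⊆ (n ∷ ns) zero    p = ∈-++⁺ˡ p
    ins⊆ (n ∷ ns) (suc i) p = ∈-++⁺ʳ (newInputs n) (ins⊆ ns i p)

    ⊆ins : ∀ {w} (ns : List (NewNode X.Wire)) → w ∈ concatMap newInputs ns → ∃[ i ] w ∈ newInputs (lookup ns i)
    ⊆ins (n ∷ ns) p with ∈-++⁻ (newInputs n) p
    ... | inj₁ q = zero , q
    ... | inj₂ q with i , r ← ⊆ins ns q = suc i , r

    unique-split : Unique (rest ++ concatMap newInputs new)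
    unique-split = PermutationSetoid.Unique-resp-↭ (setoid _) (↭⇒↭ₛ split) X.exits-unique

    unique-ins : ∀ (ns : List (NewNode X.Wire)) → Unique (concatMap newInputs ns) → ∀ i → Unique (newInputs (lookup ns i))
    unique-ins (n ∷ ns) u zero    = Unique-++ˡ (newInputs n) u
    unique-ins (n ∷ ns) u (suc i) = unique-ins ns (Unique-++ʳ (newInputs n) u) i

    separate : ∀ {w} (ns : List (NewNode X.Wire)) → Unique (concatMap newInputs ns) → ∀ i j →
               w ∈ newInputs (lookup ns i) → w ∈ newInputs (lookup ns j) → i ≡ j
    separate (n ∷ ns) u zero    zero    p q = refl
    separate (n ∷ ns) u zero    (suc j) p q = contradiction (ins⊆ ns j q) (Unique-++-disjoint (newInputs n) u p)
    separate (n ∷ ns) u (suc i) zero    p q = contradiction (ins⊆ ns i p) (Unique-++-disjoint (newInputs n) u q)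
    separate (n ∷ ns) u (suc i) (suc j) p q = cong suc (separate ns (Unique-++ʳ (newInputs n) u) i j p q)

    unique-new : Unique (concatMap newInputs new)
    unique-new = Unique-++ʳ rest unique-split

    free : ∀ {w} i → w ∈ ins i → X.tgt w ≡ nothing
    free i p = Equivalence.to (X.exits-complete _) (∈-resp-↭ (↭-sym split) (∈-++⁺ʳ rest (ins⊆ new i p)))

    tgt-new : ∀ {w} i → w ∈ ins i → tgt (inj₁ w) ≡ just (inj₂ i)
    tgt-new {w} i p with consumer w
    ... | yes (j , q) = cong (just ∘ inj₂) (separate new unique-new j i q p)
    ... | no  ¬q      = contradiction (i , p) ¬q

    tgt-old : ∀ {w v} → X.tgt w ≡ just v → tgt (inj₁ w) ≡ just (inj₁ v)
    tgt-old {w} eq with consumer w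
    ... | yes (j , q) with () ← trans (sym eq) (free j q)
    ... | no  _       = cong (Maybe.map inj₁) eq

    tgt-old⁻ : ∀ {w v} → tgt (inj₁ w) ≡ just (inj₁ v) → X.tgt w ≡ just v
    tgt-old⁻ {w} eq with consumer w
    tgt-old⁻ {w} () | yes _
    tgt-old⁻ {w} eq | no _ with X.tgt w
    tgt-old⁻ {w} refl | no _ | just _ = refl

    tgt-new⁻ : ∀ {w i} → tgt (inj₁ w) ≡ just (inj₂ i) → w ∈ ins i
    tgt-new⁻ {w} eq with consumer w
    tgt-new⁻ {w} refl | yes (_ , p) = p
    tgt-new⁻ {w} eq | no _ with X.tgt w
    tgt-new⁻ {w} () | no _ | just _
    tgt-new⁻ {w} () | no _ | nothing

    inc-old : ∀ {v ws} → Incoming X.src X.tgt X.label v ws → Incoming src tgt label (inj₁ v) (map inj₁ ws)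
    inc-old {v} {ws} inc w = mk⇔ (to w) from
      where
      to : ∀ w → tgt w ≡ just (inj₁ v) → w ∈ map inj₁ ws
      to (inj₁ w) eq = ∈-map⁺ inj₁ (Equivalence.to (inc w) (tgt-old⁻ eq))
      from : ∀ {w} → w ∈ map inj₁ ws → tgt w ≡ just (inj₁ v)
      from p with _ , q , refl ← ∈-map⁻ inj₁ p = tgt-old (Equivalence.from (inc _) q)

    out-old : ∀ {v ws} → Outgoing X.src X.tgt X.label v ws → Outgoing src tgt label (inj₁ v) (map inj₁ ws)
    out-old {v} {ws} out w = mk⇔ (to w) from
      where
      to : ∀ w → src w ≡ inj₁ v → w ∈ map inj₁ ws
      to (inj₁ w) refl = ∈-map⁺ inj₁ (Equivalence.to (out w) refl)
      from : ∀ {w} → w ∈ map inj₁ ws → src w ≡ inj₁ v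
      from p with _ , q , refl ← ∈-map⁻ inj₁ p = cong inj₁ (Equivalence.from (out _) q)

    inc-new : ∀ i → Incoming src tgt label (inj₂ i) (map inj₁ (ins i))
    inc-new i w = mk⇔ (to w) from
      where
      to : ∀ w → tgt w ≡ just (inj₂ i) → w ∈ map inj₁ (ins i)
      to (inj₁ w) eq = ∈-map⁺ inj₁ (tgt-new⁻ eq)
      from : ∀ {w} → w ∈ map inj₁ (ins i) → tgt w ≡ just (inj₂ i)
      from p with _ , q , refl ← ∈-map⁻ inj₁ p = tgt-new i q

    out-new : ∀ i → Outgoing src tgt label (inj₂ i) (inj₂ i ∷ [])
    out-new i w = mk⇔ (to w) λ { (here refl) → refl }
      where
      to : ∀ w → src w ≡ inj₂ i → w ∈ inj₂ i ∷ []
      to (inj₂ _) refl = here refl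

    wellFormed : ∀ v → WellFormed src tgt label v (kind v)
    wellFormed (inj₁ v) with X.kind v | X.wellFormed v
    ... | _ | axiom P a b a≢b i o p q       = axiom P (inj₁ a) (inj₁ b) (a≢b ∘ inj₁-injective) (inc-old i) (out-old o) p q
    ... | _ | contraction a b c a≢b i o p q = contraction (inj₁ a) (inj₁ b) (inj₁ c) (a≢b ∘ inj₁-injective) (inc-old i) (out-old o) p q
    ... | _ | binary □ l r c l≢r i o p      = binary □ (inj₁ l) (inj₁ r) (inj₁ c) (l≢r ∘ inj₁-injective) (inc-old i) (out-old o) p
    ... | _ | plus s a c B i o p            = plus s (inj₁ a) (inj₁ c) B (inc-old i) (out-old o) p
    wellFormed (inj₂ i) = new-wellFormed (lookup new i) refl
      where
      head≢ : ∀ {a b : X.Wire} → ins i ≡ a ∷ b ∷ [] → _≢_ {A = X.Wire ⊎ New} (inj₁ a) (inj₁ b)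
      head≢ eq refl with (a≢a ∷ []) ∷ _ ← subst Unique eq (unique-ins new unique-new i) = a≢a refl
      inc : ∀ {ws} → ins i ≡ ws → Incoming src tgt label (inj₂ i) (map inj₁ ws)
      inc refl = inc-new i
      new-wellFormed : ∀ n → lookup new i ≡ n → WellFormed src tgt label (inj₂ i) (newKind inj₁ n)
      new-wellFormed (contraction a b) eq = contraction (inj₁ a) (inj₁ b) (inj₂ i)
        (head≢ (cong newInputs eq)) (inc (cong newInputs eq)) (out-new i)
        (cong (newLabel X.label) (sym eq))
        (trans (subst (Consistent X.label) eq (All.lookup consistent (∈-lookup i))) (cong (newLabel X.label) (sym eq)))
      new-wellFormed (binary □ l r) eq = binary □ (inj₁ l) (inj₁ r) (inj₂ i)
        (head≢ (cong newInputs eq)) (inc (cong newInputs eq)) (out-new i) (cong (newLabel X.label) eq)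
      new-wellFormed (plus s a B) eq = plus s (inj₁ a) (inj₂ i) B
        (inc (cong newInputs eq)) (out-new i) (cong (newLabel X.label) eq)

    tgt≢src : ∀ w → tgt w ≢ just (src w)
    tgt≢src (inj₁ w) eq = X.tgt≢src w (tgt-old⁻ eq)

    unordered : List (X.Wire ⊎ New)
    unordered = map inj₁ rest ++ map inj₂ (allFin (length new))

    unordered-unique : Unique unordered
    unordered-unique = Unique.++⁺ (Unique.map⁺ inj₁-injective (Unique-++ˡ rest unique-split))
                                  (Unique.map⁺ inj₂-injective (Unique.allFin⁺ _)) disjoint
      where
      disjoint : ∀ {w} → ¬ (w ∈ map inj₁ rest × w ∈ map inj₂ (allFin (length new)))
      disjoint (p , q) with ∈-map⁻ inj₁ p | ∈-map⁻ inj₂ q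
      ... | _ , _ , refl | _ , _ , ()

    complete⁺ : ∀ w → w ∈ unordered → tgt w ≡ nothing
    complete⁺ (inj₂ _) _ = refl
    complete⁺ (inj₁ w) p with ∈-++⁻ (map inj₁ rest) p
    ... | inj₂ q with _ , _ , () ← ∈-map⁻ inj₂ q
    ... | inj₁ q with _ , r , refl ← ∈-map⁻ inj₁ q with consumer w
    ... | yes (i , s) = contradiction (ins⊆ new i s) (Unique-++-disjoint rest unique-split r)
    ... | no  _ = cong (Maybe.map inj₁) (Equivalence.to (X.exits-complete w) (∈-resp-↭ (↭-sym split) (∈-++⁺ˡ r)))

    complete⁻ : ∀ w → tgt w ≡ nothing → w ∈ unordered
    complete⁻ (inj₂ i) _ = ∈-++⁺ʳ (map inj₁ rest) (∈-map⁺ inj₂ (∈-allFin i))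
    complete⁻ (inj₁ w) eq with consumer w
    complete⁻ (inj₁ w) () | yes _
    complete⁻ (inj₁ w) eq | no ¬s with X.tgt w in eq′
    complete⁻ (inj₁ w) () | no ¬s | just _
    complete⁻ (inj₁ w) eq | no ¬s | nothing
      with ∈-++⁻ rest (∈-resp-↭ split (Equivalence.from (X.exits-complete w) eq′))
    ... | inj₁ r = ∈-++⁺ˡ (∈-map⁺ inj₁ r)
    ... | inj₂ s = contradiction (⊆ins new s) ¬s

    attach : PreCircuit
    attach = record
      { Node           = X.Node ⊎ New
      ; Wire           = X.Wire ⊎ New
      ; node-finite    = ⊎-finite X.node-finite (length new , ↔-refl)
      ; wire-finite    = ⊎-finite X.wire-finite (length new , ↔-refl)
      ; kind           = kind
      ; src            = src
      ; tgt            = tgt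
      ; label          = label
      ; tgt≢src        = tgt≢src
      ; wellFormed     = wellFormed
      ; exits          = es
      ; exits-unique   = PermutationSetoid.Unique-resp-↭ (setoid _) (↭⇒↭ₛ (↭-sym order)) unordered-unique
      ; exits-complete = λ w → mk⇔ (complete⁺ w ∘ ∈-resp-↭ order) (∈-resp-↭ (↭-sym order) ∘ complete⁻ w)
      }

    old-connected : ∀ {u v} → X.Connected u v → PreCircuit.Connected attach (inj₁ u) (inj₁ v)
    old-connected = gmap inj₁ λ { (w , p , q) → inj₁ w , cong inj₁ p , tgt-old q }

    new-connected : ∀ {w} i → w ∈ ins i → PreCircuit.Connected attach (inj₁ (X.src w)) (inj₂ i)
    new-connected {w} i p = return (inj₁ w , refl , tgt-new i p)

  connected-to : ∀ {X : PreCircuit} (let open PreCircuit X) r → (∀ v → Connected r v) → ∀ u v → Connected u v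
  connected-to r p u v = symmetric _ (p u) ◅◅ p v

  -- Each operation below is given the exits of its arguments, in order.

  axiomCircuit : Literal → Circuit
  axiomCircuit P = record
    { preCircuit = record
      { Node           = Fin 1
      ; Wire           = Fin 2
      ; node-finite    = 1 , ↔-refl
      ; wire-finite    = 2 , ↔-refl
      ; kind           = λ _ → axiom
      ; src            = λ _ → zero
      ; tgt            = λ _ → nothing
      ; label          = λ { zero → lit P ; (suc zero) → lit (dual P) }
      ; tgt≢src        = λ _ ()
      ; wellFormed     = λ { zero → axiom P zero (suc zero) (λ ()) (λ _ → mk⇔ (λ ()) (λ ()))
                                      (λ w → mk⇔ (λ _ → all w) (λ _ → refl)) refl refl }
      ; exits          = zero ∷ suc zero ∷ []
      ; exits-unique   = ((λ ()) ∷ []) ∷ [] ∷ []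
      ; exits-complete = λ w → mk⇔ (λ _ → refl) (λ _ → all w)
      }
    ; nonEmpty  = zero
    ; connected = λ { zero zero → ε }
    }
    where
    all : (w : Fin 2) → w ∈ zero ∷ suc zero ∷ []
    all zero       = here refl
    all (suc zero) = there (here refl)

  module _ (X : Circuit) where

    open Circuit X

    reorder : (es : List Wire) → exits ↭ es → Circuit
    reorder es order = record
      { preCircuit = record preCircuit
        { exits          = es
        ; exits-unique   = PermutationSetoid.Unique-resp-↭ (setoid _) (↭⇒↭ₛ order) exits-unique
        ; exits-complete = λ w → mk⇔ (Equivalence.to (exits-complete w) ∘ ∈-resp-↭ (↭-sym order))
                                     (∈-resp-↭ order ∘ Equivalence.from (exits-complete w))
        }
      ; nonEmpty  = nonEmpty
      ; connected = connected
      }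

    attachOne : (n : NewNode Wire) → Consistent label n → (ws : List Wire) → exits ≡ ws ++ newInputs n → Circuit
    attachOne n consistent ws eq = record
      { preCircuit = A.attach
      ; nonEmpty   = inj₂ zero
      ; connected  = connected-to {A.attach} (inj₂ zero) λ
          { (inj₁ v)    → symmetric _ (A.new-connected zero (first n .proj₂)) ◅◅ A.old-connected (connected _ v)
          ; (inj₂ zero) → ε }
      }
      where
      module A = Attach preCircuit (n ∷ []) (consistent ∷ []) ws
        (↭-reflexive (trans eq (cong (ws ++_) (sym (++-identityʳ _)))))
        (map inj₁ ws ++ inj₂ zero ∷ []) ↭-refl
      first : ∀ n → ∃[ w ] w ∈ newInputs n
      first (contraction a b) = a , here refl
      first (binary □ l r)    = l , here refl
      first (plus s a B)      = a , here refl

    parCircuit : ∀ ws a b → exits ≡ ws ++ a ∷ b ∷ [] → Circuit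
    parCircuit ws a b = attachOne (binary par a b) tt ws

    plusCircuit : Side → Formula → ∀ ws a → exits ≡ ws ++ a ∷ [] → Circuit
    plusCircuit s B ws a = attachOne (plus s a B) tt ws

  module _ (X Y : Circuit) where

    private
      module X = Circuit X
      module Y = Circuit Y
      module X⊎Y = PreCircuit (X.preCircuit ⊎ᴾ Y.preCircuit)

      connectedˡ : ∀ u v → X⊎Y.Connected (inj₁ u) (inj₁ v)
      connectedˡ u v = gmap inj₁ (λ { (w , p , q) → inj₁ w , cong inj₁ p , cong (Maybe.map inj₁) q }) (X.connected u v)

      connectedʳ : ∀ u v → X⊎Y.Connected (inj₂ u) (inj₂ v)
      connectedʳ u v = gmap inj₂ (λ { (w , p , q) → inj₂ w , cong inj₂ p , cong (Maybe.map inj₂) q }) (Y.connected u v)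

    module TensorCircuit
      (ws : List X.Wire) (a : X.Wire) (eqX : X.exits ≡ ws ++ a ∷ [])
      (us : List Y.Wire) (b : Y.Wire) (eqY : Y.exits ≡ b ∷ us)
      where

      order : List (X⊎Y.Wire ⊎ Fin 1)
      order = map (inj₁ ∘ inj₁) ws ++ inj₂ zero ∷ map (inj₁ ∘ inj₂) us

      split : X⊎Y.exits ↭ (map inj₁ ws ++ map inj₂ us) ++ inj₁ a ∷ inj₂ b ∷ []
      split = begin
        map inj₁ X.exits ++ map inj₂ Y.exits               ≡⟨ cong₂ (λ es fs → map inj₁ es ++ map inj₂ fs) eqX eqY ⟩
        map inj₁ (ws ++ a ∷ []) ++ inj₂ b ∷ map inj₂ us    ≡⟨ cong (_++ inj₂ b ∷ map inj₂ us) (map-++ inj₁ ws (a ∷ [])) ⟩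
        (map inj₁ ws ++ inj₁ a ∷ []) ++ inj₂ b ∷ map inj₂ us ≡⟨ ++-assoc (map inj₁ ws) _ _ ⟩
        map inj₁ ws ++ inj₁ a ∷ inj₂ b ∷ map inj₂ us       ↭⟨ ++⁺ˡ (map inj₁ ws) (++-comm (inj₁ a ∷ inj₂ b ∷ []) (map inj₂ us)) ⟩
        map inj₁ ws ++ map inj₂ us ++ inj₁ a ∷ inj₂ b ∷ [] ≡⟨ ++-assoc (map inj₁ ws) _ _ ⟨
        (map inj₁ ws ++ map inj₂ us) ++ inj₁ a ∷ inj₂ b ∷ [] ∎
        where open PermutationReasoning

      order-↭ : order ↭ map inj₁ (map inj₁ ws ++ map inj₂ us) ++ inj₂ zero ∷ []
      order-↭ = begin
        map (inj₁ ∘ inj₁) ws ++ inj₂ zero ∷ map (inj₁ ∘ inj₂) us   ↭⟨ ++⁺ˡ (map (inj₁ ∘ inj₁) ws) (++-comm (inj₂ zero ∷ []) _) ⟩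
        map (inj₁ ∘ inj₁) ws ++ map (inj₁ ∘ inj₂) us ++ inj₂ zero ∷ [] ≡⟨ ++-assoc (map (inj₁ ∘ inj₁) ws) _ _ ⟨
        (map (inj₁ ∘ inj₁) ws ++ map (inj₁ ∘ inj₂) us) ++ inj₂ zero ∷ [] ≡⟨ cong (_++ inj₂ zero ∷ []) (cong₂ _++_ (map-∘ ws) (map-∘ us)) ⟩
        (map inj₁ (map inj₁ ws) ++ map inj₁ (map inj₂ us)) ++ inj₂ zero ∷ [] ≡⟨ cong (_++ inj₂ zero ∷ []) (map-++ inj₁ (map inj₁ ws) _) ⟨
        map inj₁ (map inj₁ ws ++ map inj₂ us) ++ inj₂ zero ∷ [] ∎
        where open PermutationReasoning

      module A = Attach (X.preCircuit ⊎ᴾ Y.preCircuit)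
        (binary tensor (inj₁ a) (inj₂ b) ∷ []) (tt ∷ [])
        (map inj₁ ws ++ map inj₂ us) split order order-↭

      circuit : Circuit
      circuit = record
        { preCircuit = A.attach
        ; nonEmpty   = inj₂ zero
        ; connected  = connected-to {A.attach} (inj₂ zero) λ
            { (inj₁ (inj₁ v)) → symmetric _ (A.new-connected zero (here refl)) ◅◅ A.old-connected (connectedˡ _ v)
            ; (inj₁ (inj₂ v)) → symmetric _ (A.new-connected zero (there (here refl))) ◅◅ A.old-connected (connectedʳ _ v)
            ; (inj₂ zero)     → ε }
        }

    module WithCircuit
      (ws : List X.Wire) (a : X.Wire) (eqX : X.exits ≡ ws ++ a ∷ [])
      (us : List Y.Wire) (b : Y.Wire) (eqY : Y.exits ≡ us ++ b ∷ [])
      (same : map X.label ws ≡ map Y.label us)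
      where

      contractions : List X.Wire → List Y.Wire → List (NewNode X⊎Y.Wire)
      contractions = zipWith (λ w u → contraction (inj₁ w) (inj₂ u))

      new : List (NewNode X⊎Y.Wire)
      new = contractions ws us ++ binary with′ (inj₁ a) (inj₂ b) ∷ []

      order : List (X⊎Y.Wire ⊎ Fin (length new))
      order = map inj₂ (allFin (length new))

      consistent : ∀ ws us → map X.label ws ≡ map Y.label us →
                   All (Consistent X⊎Y.label) (contractions ws us ++ binary with′ (inj₁ a) (inj₂ b) ∷ [])
      consistent []       us       eq = tt ∷ []
      consistent (w ∷ ws) (u ∷ us) eq = sym (∷-injectiveˡ eq) ∷ consistent ws us (∷-injectiveʳ eq)

      split′ : ∀ ws us → map X.label ws ≡ map Y.label us →
               map inj₁ (ws ++ a ∷ []) ++ map inj₂ (us ++ b ∷ []) ↭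
               concatMap newInputs (contractions ws us ++ binary with′ (inj₁ a) (inj₂ b) ∷ [])
      split′ []       []       eq = ↭-refl
      split′ (w ∷ ws) (u ∷ us) eq = prep (inj₁ w) (begin
        map inj₁ (ws ++ a ∷ []) ++ inj₂ u ∷ map inj₂ (us ++ b ∷ []) ↭⟨ shift (inj₂ u) (map inj₁ (ws ++ a ∷ [])) _ ⟩
        inj₂ u ∷ map inj₁ (ws ++ a ∷ []) ++ map inj₂ (us ++ b ∷ []) ↭⟨ prep (inj₂ u) (split′ ws us (∷-injectiveʳ eq)) ⟩
        inj₂ u ∷ concatMap newInputs (contractions ws us ++ binary with′ (inj₁ a) (inj₂ b) ∷ []) ∎)
        where open PermutationReasoning

      split : X⊎Y.exits ↭ concatMap newInputs new
      split = ↭-trans (↭-reflexive (cong₂ (λ es fs → map inj₁ es ++ map inj₂ fs) eqX eqY)) (split′ ws us same)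

      module A = Attach (X.preCircuit ⊎ᴾ Y.preCircuit) new (consistent ws us same) [] split order ↭-refl

      leftInputs : ∀ ws us → All (λ n → ∃[ w ] inj₁ w ∈ newInputs n) (contractions ws us ++ binary with′ (inj₁ a) (inj₂ b) ∷ [])
      leftInputs []       us       = (a , here refl) ∷ []
      leftInputs (w ∷ ws) []       = (a , here refl) ∷ []
      leftInputs (w ∷ ws) (u ∷ us) = (w , here refl) ∷ leftInputs ws us

      with∈new : binary with′ (inj₁ a) (inj₂ b) ∈ new
      with∈new = ∈-++⁺ʳ (contractions ws us) (here refl)

      withNode : Fin (length new)
      withNode = index with∈new

      input-with : ∀ {w} → w ∈ inj₁ a ∷ inj₂ b ∷ [] → w ∈ newInputs (lookup new withNode)
      input-with {w} = subst (λ n → w ∈ newInputs n) (lookup-index with∈new)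

      circuit : Circuit
      circuit = record
        { preCircuit = A.attach
        ; nonEmpty   = inj₁ (inj₁ X.nonEmpty)
        ; connected  = connected-to {A.attach} (inj₁ (inj₁ (X.src a))) λ
            { (inj₁ (inj₁ v)) → A.old-connected (connectedˡ _ v)
            ; (inj₁ (inj₂ v)) → A.new-connected withNode (input-with (here refl))
                                ◅◅ symmetric _ (A.new-connected withNode (input-with (there (here refl))))
                                ◅◅ A.old-connected (connectedʳ _ v)
            ; (inj₂ i)        → A.old-connected (connectedˡ _ _)
                                ◅◅ A.new-connected i (All.lookup (leftInputs ws us) (∈-lookup i) .proj₂) }
        }

      conclusion-circuit : Circuit.conclusion circuit ≡ map X.label ws ++ X.label a & Y.label b ∷ []
      conclusion-circuit = begin
        map A.label (map inj₂ (allFin (length new)))            ≡⟨ map-∘ (allFin _) ⟨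
        map (newLabel X⊎Y.label ∘ lookup new) (allFin _)        ≡⟨ map-tabulate id (newLabel X⊎Y.label ∘ lookup new) ⟩
        tabulate (newLabel X⊎Y.label ∘ lookup new)              ≡⟨ map-tabulate (lookup new) (newLabel X⊎Y.label) ⟨
        map (newLabel X⊎Y.label) (tabulate (lookup new))        ≡⟨ cong (map _) (tabulate-lookup new) ⟩
        map (newLabel X⊎Y.label) new                            ≡⟨ labels ws us same ⟩
        map X.label ws ++ X.label a & Y.label b ∷ []            ∎
        where
        open ≡-Reasoning
        labels : ∀ ws us → map X.label ws ≡ map Y.label us →
                 map (newLabel X⊎Y.label) (contractions ws us ++ binary with′ (inj₁ a) (inj₂ b) ∷ []) ≡
                 map X.label ws ++ X.label a & Y.label b ∷ []
        labels []       us       eq = refl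
        labels (w ∷ ws) (u ∷ us) eq = cong (X.label w ∷_) (labels ws us (∷-injectiveʳ eq))

  -- The exits of a circuit with conclusion Γ ++ A ∷ [], resp. Γ ++ A ∷ B ∷ [],
  -- resp. B ∷ Δ, separated accordingly.
  module _ (X : Circuit) where

    open Circuit X

    last : ∀ {Γ A} → conclusion ≡ Γ ++ A ∷ [] →
           Σ[ ws ∈ List Wire ] Σ[ a ∈ Wire ] exits ≡ ws ++ a ∷ [] × map label ws ≡ Γ × label a ≡ A
    last {Γ} {A} eq with unmap-++ label exits {Γ} {A ∷ []} eq
    ... | ws , a ∷ [] , p , q , refl = ws , a , p , q , refl

    lastTwo : ∀ {Γ A B} → conclusion ≡ Γ ++ A ∷ B ∷ [] →
              Σ[ ws ∈ List Wire ] Σ[ a ∈ Wire ] Σ[ b ∈ Wire ]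
              exits ≡ ws ++ a ∷ b ∷ [] × map label ws ≡ Γ × label a ≡ A × label b ≡ B
    lastTwo {Γ} {A} {B} eq with unmap-++ label exits {Γ} {A ∷ B ∷ []} eq
    ... | ws , a ∷ b ∷ [] , p , q , refl = ws , a , b , p , q , refl , refl

    first : ∀ {B Δ} → conclusion ≡ B ∷ Δ →
            Σ[ b ∈ Wire ] Σ[ us ∈ List Wire ] exits ≡ b ∷ us × label b ≡ B × map label us ≡ Δ
    first {B} {Δ} eq with unmap-++ label exits {B ∷ []} {Δ} eq
    ... | b ∷ [] , us , p , refl , q = b , us , p , refl , q

  translate            : ∀ {Γ} → ⊢ Γ → Circuit
  conclusion-translate : ∀ {Γ} (π : ⊢ Γ) → Circuit.conclusion (translate π) ≡ Γ

  translate (axiom P) = axiomCircuit P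
  -- ↭-map-inv lets the permutation of the formulas act on the exits.
  translate (perm {Δ = Δ} σ π) =
    let es , _ , order = ↭-map-inv (Circuit.label (translate π)) (subst (λ Γ → Γ ↭ Δ) (sym (conclusion-translate π)) σ)
    in reorder (translate π) es order
  translate (par Γ π) =
    let ws , a , b , eq , _ = lastTwo (translate π) (conclusion-translate π)
    in parCircuit (translate π) ws a b eq
  translate (plus Γ s B π) =
    let ws , a , eq , _ = last (translate π) (conclusion-translate π)
    in plusCircuit (translate π) s B ws a eq
  translate (tensor Γ Δ π ρ) =
    let ws , a , eqX , _ = last (translate π) (conclusion-translate π)
        b , us , eqY , _ = first (translate ρ) (conclusion-translate ρ)
    in TensorCircuit.circuit (translate π) (translate ρ) ws a eqX us b eqY
  translate (with′ Γ π ρ) =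
    let ws , a , eqX , p , _ = last (translate π) (conclusion-translate π)
        us , b , eqY , q , _ = last (translate ρ) (conclusion-translate ρ)
    in WithCircuit.circuit (translate π) (translate ρ) ws a eqX us b eqY (trans p (sym q))

  conclusion-translate (axiom P) = refl
  conclusion-translate (perm {Δ = Δ} σ π) =
    let _ , eq , _ = ↭-map-inv (Circuit.label (translate π)) (subst (λ Γ → Γ ↭ Δ) (sym (conclusion-translate π)) σ)
    in sym eq
  conclusion-translate (par Γ π) =
    let ws , a , b , _ , p , q , r = lastTwo (translate π) (conclusion-translate π)
    in trans (map-++ _ (map inj₁ ws) _)
             (cong₂ _++_ (trans (sym (map-∘ ws)) p) (cong (_∷ []) (cong₂ _⅋_ q r)))
  conclusion-translate (plus Γ s B π) =
    let ws , a , _ , p , q = last (translate π) (conclusion-translate π)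
    in trans (map-++ _ (map inj₁ ws) _)
             (cong₂ _++_ (trans (sym (map-∘ ws)) p) (cong (λ A → plusFormula s A B ∷ []) q))
  conclusion-translate (tensor Γ Δ π ρ) =
    let ws , a , _ , p , q = last (translate π) (conclusion-translate π)
        b , us , _ , r , s = first (translate ρ) (conclusion-translate ρ)
    in trans (map-++ _ (map (inj₁ ∘ inj₁) ws) _)
             (cong₂ _++_ (trans (sym (map-∘ ws)) p)
                         (cong₂ _∷_ (cong₂ _⊗_ q r) (trans (sym (map-∘ us)) s)))
  conclusion-translate (with′ Γ π ρ) =
    let ws , a , eqX , p , q = last (translate π) (conclusion-translate π)
        us , b , eqY , r , s = last (translate ρ) (conclusion-translate ρ)
    in trans (WithCircuit.conclusion-circuit (translate π) (translate ρ) ws a eqX us b eqY (trans p (sym r)))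
             (cong₂ _++_ p (cong (_∷ []) (cong₂ _&_ q s)))

  Sequentializable : Circuit → Set
  Sequentializable X = ∃₂ λ Γ (π : ⊢ Γ) → X ≅ translate π

{-# OPTIONS --safe #-}

-- Exit orders are immaterial: a permutation rule can realise any of them, and
-- the residual circuits of a step inherit some order.  So everything is done up
-- to isomorphism ignoring exits.  Up to that, a step X ⤳[ N ] S and the last
-- logical rule of a proof are the same data: X consists of the circuits in S
-- and the deleted nodes attached below them.  An erasure sequence is therefore
-- a tree of steps, and such trees are translated into proofs and back rule by
-- rule.  The only real graph argument is that deleting a final plus or tensor
-- node leaves components each containing the source of one of its inputs.

module Submission where

open import Defs
open import Data.Fin.Base using (Fin; zero; suc)
open import Data.List.Base using (List; []; _∷_; _++_; map; concatMap; length; allFin; zipWith; lookup)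
import Data.List.Membership.DecPropositional as DecMembership
open import Data.List.Membership.Propositional using (_∈_; _∉_; find; lose)
open import Data.List.Membership.Propositional.Properties using (∈-map⁺; ∈-map⁻; ∈-∃++; ∈-concatMap⁺; ∈-++⁺ʳ; ∈-++⁺ˡ; ∈-lookup)
open import Data.List.Membership.Propositional.Properties.WithK using (unique∧set⇒bag)
open import Data.List.Properties using (++-identityʳ; ∷ʳ-injective; ∷ʳ-injectiveʳ; ++-assoc; map-++; ∷-injectiveˡ; ∷-injectiveʳ; map-∘; map-cong; map-cong-local)
open import Data.List.Relation.Binary.BagAndSetEquality using (∼bag⇒↭)
open import Data.List.Relation.Binary.Permutation.Propositional using (_↭_; refl; prep; swap; ↭-refl; ↭-sym; ↭-trans; ↭-reflexive; ↭⇒↭ₛ)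
open import Data.List.Relation.Binary.Permutation.Propositional.Properties using (↭-map-inv; ↭-singleton-inv; map⁺; ∈-resp-↭; All-resp-↭; shift; ↭-empty-inv; ++-comm)
import Data.List.Relation.Binary.Permutation.Setoid.Properties as PermutationSetoid
open import Data.List.Relation.Binary.Pointwise using (Pointwise; []; _∷_)
open import Data.List.Relation.Binary.Sublist.Propositional using (_⊆_; []; _∷_; _∷ʳ_)
open import Data.List.Relation.Unary.All as All using (All; []; _∷_)
import Data.List.Relation.Unary.All.Properties as All
open import Data.List.Relation.Unary.AllPairs using ([]; _∷_)
open import Data.List.Relation.Unary.Any as Any using (Any; here; there)
open import Data.List.Relation.Unary.Any.Properties using (lookup-index)
open import Data.List.Relation.Unary.Unique.Propositional using (Unique)
import Data.List.Relation.Unary.Unique.Propositional.Properties as Unique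
open import Data.Maybe.Base as Maybe using (just; nothing)
open import Data.Maybe.Properties using (just-injective)
open import Data.Product.Base using (Σ-syntax; ∃₂; ∃-syntax; _×_; _,_; proj₁; proj₂)
open import Data.Sum.Base as Sum using (_⊎_; inj₁; inj₂; [_,_]′)
open import Data.Sum.Properties using (inj₁-injective; inj₂-injective)
open import Data.Unit.Base using (⊤; tt)
open import Function.Base using (_∘_; id)
open import Function.Bundles using (_⇔_; mk⇔; mk↔ₛ′; module Equivalence; module Inverse; Injection; _↔_)
open import Function.Definitions using (Injective)
open import Function.Properties.Inverse using (Inverse⇒Injection)
open import Relation.Binary.Construct.Closure.Equivalence using (return; gmap; symmetric)
open import Relation.Binary.Construct.Closure.ReflexiveTransitive using (ε; _◅_; _◅◅_)
open import Relation.Binary.Construct.Closure.Symmetric using (fwd; bwd)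
open import Relation.Binary.Definitions using (DecidableEquality)
open import Relation.Binary.PropositionalEquality using (_≡_; _≢_; refl; sym; trans; cong; cong₂; subst; setoid; subst-sym-subst)
open import Relation.Nullary using (¬_; yes; no; contradiction)

-- Two exits may carry the same formula, so a permutation of formulas does not fix a permutation of
-- wires: `translate` reads the new exit order of a `perm` rule off the computation of `↭-map-inv`.
-- That every exit order can be realised is therefore a fact about how this function computes, not
-- about its type.
--
-- One relation, `Part X Q Y`, serves for isomorphism (`Q` everything), for what a deletion leaves
-- (`Q` the complement of the deleted nodes) and for a component (`Q` a connectivity class);
-- composing parts replaces most reasoning about renamings.
--
-- The choices in a step do not match those in a rule. Representatives of components are arbitrary,
-- and the inputs of a contraction are unordered. From steps to rules, the components are matched
-- with the left and right input of the ready node, and for `with′` the inputs of every contraction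
-- are sorted by component. From rules to steps, the claim is made for all `X ∼ translate π`,
-- because residual circuits inherit an exit order that the proof does not choose.

private
  variable
    A B C : Set

-- Renaming of kinds; permutations of lists without repetition

↔-injective : (i : A ↔ B) → Injective _≡_ _≡_ (Inverse.to i)
↔-injective i = Injection.injective (Inverse⇒Injection i)

mapKind-∘ : (f : B → C) (g : A → B) → ∀ k → mapKind f (mapKind g k) ≡ mapKind (f ∘ g) k
mapKind-∘ f g axiom          = refl
mapKind-∘ f g contraction    = refl
mapKind-∘ f g (binary □ l r) = refl
mapKind-∘ f g (plus s)       = refl

mapKind-id : {f : A → A} → (∀ x → f x ≡ x) → ∀ k → mapKind f k ≡ k
mapKind-id f≗id axiom          = refl
mapKind-id f≗id contraction    = refl
mapKind-id f≗id (binary □ l r) = cong₂ (binary □) (f≗id l) (f≗id r)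
mapKind-id f≗id (plus s)       = refl

Unique-resp-↭ : {xs ys : List A} → xs ↭ ys → Unique xs → Unique ys
Unique-resp-↭ p = PermutationSetoid.Unique-resp-↭ (setoid _) (↭⇒↭ₛ p)

Unique-set⇒↭ : {xs ys : List A} → Unique xs → Unique ys →
               (∀ {x} → x ∈ xs → x ∈ ys) → (∀ {x} → x ∈ ys → x ∈ xs) → xs ↭ ys
Unique-set⇒↭ u v f g = ∼bag⇒↭ (unique∧set⇒bag u v (mk⇔ f g))

↭-to-front : ∀ {x : A} {xs} → x ∈ xs → ∃[ ys ] xs ↭ x ∷ ys
↭-to-front {x = x} p with ys , zs , refl ← ∈-∃++ p = ys ++ zs , shift x ys zs

-- Walking along `zs` puts the elements of `xs` in the order in which their images occur there. Once
-- the element over `z` is taken, uniqueness and injectivity keep the remaining images different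
-- from `z`, hence in the tail. This yields the induced exit order that `exits-⊆` asks for.
reorder-⊆ : DecidableEquality B → (f : A → B) → Injective _≡_ _≡_ f → ∀ zs {xs} → Unique xs →
            (∀ {x} → x ∈ xs → f x ∈ zs) → ∃[ ys ] xs ↭ ys × map f ys ⊆ zs
reorder-⊆ _≟_ f inj [] {[]}    u h = [] , ↭-refl , []
reorder-⊆ _≟_ f inj [] {_ ∷ _} u h with () ← h (here refl)
reorder-⊆ _≟_ f inj (z ∷ zs) {xs} u h with Any.any? (λ x → f x ≟ z) xs
... | no ¬p with ys , p , q ← reorder-⊆ _≟_ f inj zs u
      (λ m → Any.tail (λ e → ¬p (lose m e)) (h m))
    = ys , p , z ∷ʳ q
... | yes p with x , m , refl ← find p with xs′ , σ ← ↭-to-front m with x∉ ∷ u′ ← Unique-resp-↭ σ u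
    with ys , p , q ← reorder-⊆ _≟_ f inj zs u′
      (λ m′ → Any.tail (λ e → All.lookup x∉ m′ (sym (inj e))) (h (∈-resp-↭ (↭-sym σ) (there m′))))
    = x ∷ ys , ↭-trans σ (prep x p) , refl ∷ q

-- The exit order that `translate` gives to a `perm` rule is the list returned by `↭-map-inv`. When
-- the permutation is the image of `p`, that list is `ys`; the permutation returned with it may
-- differ from `p`, hence the existential. The cases follow those of `↭-map-inv`, which treats lists
-- of length at most one before looking at the permutation.
↭-map-inv-map⁺ : (f : A → B) → ∀ {xs ys} (p : xs ↭ ys) → ∃[ q ] ↭-map-inv f (map⁺ f p) ≡ (ys , refl , q)
↭-map-inv-map⁺ f {[]} p with refl ← ↭-empty-inv (↭-sym p) = helper _
  where
  -- The equation inside the triple is computed from `p` and does not reduce, so it is generalised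
  -- before being matched.
  helper : ∀ e → ∃[ q ] _≡_ {A = ∃[ ys ] [] ≡ map f ys × [] ↭ ys} ([] , e , ↭-refl) ([] , refl , q)
  helper refl = _ , refl
↭-map-inv-map⁺ f {x ∷ []} p with refl ← ↭-singleton-inv (↭-sym p) = helper _
  where
  helper : ∀ e → ∃[ q ] _≡_ {A = ∃[ ys ] f x ∷ [] ≡ map f ys × x ∷ [] ↭ ys} (x ∷ [] , e , ↭-refl) (x ∷ [] , refl , q)
  helper refl = _ , refl
↭-map-inv-map⁺ f {_ ∷ _ ∷ _} refl = _ , refl
↭-map-inv-map⁺ f {_ ∷ _ ∷ _} (prep x p)
  with q , eq ← ↭-map-inv-map⁺ f p rewrite eq = _ , refl
↭-map-inv-map⁺ f {_ ∷ _ ∷ _} (swap x y p)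
  with q , eq ← ↭-map-inv-map⁺ f p rewrite eq = _ , refl
↭-map-inv-map⁺ f {_ ∷ _ ∷ _} (_↭_.trans p₁ p₂)
  with q₁ , eq₁ ← ↭-map-inv-map⁺ f p₁ | q₂ , eq₂ ← ↭-map-inv-map⁺ f p₂ rewrite eq₁ | eq₂ = _ , refl

Unique-map-on : ∀ (f : A → B) {xs} → (∀ {x y} → x ∈ xs → y ∈ xs → f x ≡ f y → x ≡ y) → Unique xs → Unique (map f xs)
Unique-map-on f inj []       = []
Unique-map-on f inj (x∉ ∷ u) =
  All.map⁺ (All.tabulate λ y∈ eq → All.lookup x∉ y∈ (inj (here refl) (there y∈) eq))
  ∷ Unique-map-on f (λ x∈ y∈ → inj (there x∈) (there y∈)) u

↭-to-back : ∀ {x : A} {xs} → x ∈ xs → ∃[ ys ] xs ↭ ys ++ x ∷ []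
↭-to-back {x = x} p with ys , σ ← ↭-to-front p = ys , ↭-trans σ (++-comm (x ∷ []) ys)

↭-to-back₂ : ∀ {x y : A} {xs} → x ∈ xs → y ∈ xs → x ≢ y → ∃[ ys ] xs ↭ ys ++ x ∷ y ∷ []
↭-to-back₂ {x = x} {y} p q x≢y with ys , σ ← ↭-to-front p
  with zs , τ ← ↭-to-front (Any.tail (x≢y ∘ sym) (∈-resp-↭ σ q))
  = zs , ↭-trans σ (↭-trans (prep x τ) (++-comm (x ∷ y ∷ []) zs))

∷ʳ₂-injective : ∀ (xs ys : List A) {a b c d} → xs ++ a ∷ b ∷ [] ≡ ys ++ c ∷ d ∷ [] → a ≡ c × b ≡ d
∷ʳ₂-injective xs ys {a} {b} {c} {d} eq
  with eq′ , b≡d ← ∷ʳ-injective (xs ++ a ∷ []) (ys ++ c ∷ []) (trans (++-assoc xs _ _) (trans eq (sym (++-assoc ys _ _))))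
  = ∷ʳ-injectiveʳ xs ys eq′ , b≡d

pair-∈ : ∀ {a b x y z : A} → x ∈ a ∷ b ∷ [] → y ∈ a ∷ b ∷ [] → x ≢ y → z ∈ a ∷ b ∷ [] → z ≡ x ⊎ z ≡ y
pair-∈ (here refl)         (here refl)         x≢y _                   = contradiction refl x≢y
pair-∈ (here refl)         (there (here refl)) _   (here refl)         = inj₁ refl
pair-∈ (here refl)         (there (here refl)) _   (there (here refl)) = inj₂ refl
pair-∈ (there (here refl)) (here refl)         _   (here refl)         = inj₂ refl
pair-∈ (there (here refl)) (here refl)         _   (there (here refl)) = inj₁ refl
pair-∈ (there (here refl)) (there (here refl)) x≢y _                   = contradiction refl x≢y

-- Parts of circuits, and isomorphism up to exit order

module _ (L : Literals) where

  open MALL L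

  -- Y is, up to renaming and exit order, the full subcircuit of X on the nodes
  -- satisfying Q; as in IsComponent, wires of X leaving Q become exits of Y.
  record Part (X : PreCircuit) (Q : PreCircuit.Node X → Set) (Y : PreCircuit) : Set where
    private
      module X = PreCircuit X
      module Y = PreCircuit Y
    field
      node           : Y.Node → X.Node
      wire           : Y.Wire → X.Wire
      node-injective : Injective _≡_ _≡_ node
      wire-injective : Injective _≡_ _≡_ wire
      node-∈         : ∀ v → Q (node v)
      node-onto      : ∀ v → Q v → ∃[ v′ ] node v′ ≡ v
      wire-onto      : ∀ w → Q (X.src w) → ∃[ w′ ] wire w′ ≡ w
      kind-≡         : ∀ v → X.kind (node v) ≡ mapKind wire (Y.kind v)
      src-≡          : ∀ w → X.src (wire w) ≡ node (Y.src w)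
      tgt-⇔          : ∀ w v → Y.tgt w ≡ just v ⇔ X.tgt (wire w) ≡ just (node v)
      label-≡        : ∀ w → X.label (wire w) ≡ Y.label w

    src-∈ : ∀ w → Q (X.src (wire w))
    src-∈ w = subst Q (sym (src-≡ w)) (node-∈ (Y.src w))

    exit⁺ : ∀ {w} → X.tgt (wire w) ≡ nothing → w ∈ Y.exits
    exit⁺ {w} eq with Y.tgt w in eq′
    ... | nothing = Equivalence.from (Y.exits-complete w) eq′
    ... | just v with () ← trans (sym (Equivalence.to (tgt-⇔ w v) eq′)) eq

    exit-outside⁺ : ∀ {w v} → X.tgt (wire w) ≡ just v → ¬ Q v → w ∈ Y.exits
    exit-outside⁺ {w} eq ¬q with Y.tgt w in eq′
    ... | nothing = Equivalence.from (Y.exits-complete w) eq′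
    ... | just v with refl ← trans (sym (Equivalence.to (tgt-⇔ w v) eq′)) eq = contradiction (node-∈ v) ¬q

    exit⁻ : ∀ {w v} → w ∈ Y.exits → X.tgt (wire w) ≡ just v → ¬ Q v
    exit⁻ {w} {v} p eq q with v′ , refl ← node-onto v q
      with () ← trans (sym (Equivalence.to (Y.exits-complete w) p)) (Equivalence.from (tgt-⇔ w v′) eq)

  module _ {X Y : PreCircuit} where

    private
      module X = PreCircuit X
      module Y = PreCircuit Y

    part-⇔ : {Q R : X.Node → Set} → (∀ {v} → Q v → R v) → (∀ {v} → R v → Q v) → Part X Q Y → Part X R Y
    part-⇔ f g i = record
      { node = node ; wire = wire ; node-injective = node-injective ; wire-injective = wire-injective
      ; node-∈    = λ v → f (node-∈ v)
      ; node-onto = λ v q → node-onto v (g q)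
      ; wire-onto = λ w q → wire-onto w (g q)
      ; kind-≡ = kind-≡ ; src-≡ = src-≡ ; tgt-⇔ = tgt-⇔ ; label-≡ = label-≡ }
      where open Part i

    -- `S` has to be the image of `R` under `i`, but is not defined as that image, so that the
    -- composite can be stated for a predicate at hand, such as connectedness in `X`.
    part-∘ : {Z : PreCircuit} {Q S : X.Node → Set} {R : Y.Node → Set} (i : Part X Q Y) → Part Y R Z →
             (∀ {v} → R v → S (Part.node i v)) → (∀ {v} → S v → ∃[ v′ ] Part.node i v′ ≡ v × R v′) → Part X S Z
    part-∘ {Z} {Q} {S} {R} i j to from = record
      { node           = i.node ∘ j.node
      ; wire           = i.wire ∘ j.wire
      ; node-injective = j.node-injective ∘ i.node-injective
      ; wire-injective = j.wire-injective ∘ i.wire-injective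
      ; node-∈         = λ v → to (j.node-∈ v)
      ; node-onto      = node-onto
      ; wire-onto      = wire-onto
      ; kind-≡         = λ v → trans (i.kind-≡ _) (trans (cong (mapKind i.wire) (j.kind-≡ v)) (mapKind-∘ i.wire j.wire (Z.kind v)))
      ; src-≡          = λ w → trans (i.src-≡ _) (cong i.node (j.src-≡ w))
      ; tgt-⇔          = λ w v → mk⇔ (Equivalence.to (i.tgt-⇔ _ _) ∘ Equivalence.to (j.tgt-⇔ w v))
                                     (Equivalence.from (j.tgt-⇔ w v) ∘ Equivalence.from (i.tgt-⇔ _ _))
      ; label-≡        = λ w → trans (i.label-≡ _) (j.label-≡ w)
      }
      where
      module Z = PreCircuit Z
      module i = Part i
      module j = Part j
      node-onto : ∀ v → S v → ∃[ v′ ] i.node (j.node v′) ≡ v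
      node-onto v s with v′ , refl , r ← from s with v″ , refl ← j.node-onto v′ r = v″ , refl
      wire-onto : ∀ w → S (X.src w) → ∃[ w′ ] i.wire (j.wire w′) ≡ w
      wire-onto w s with v , eq , r ← from s with w′ , refl ← i.wire-onto w (subst Q eq (i.node-∈ v))
        with refl ← i.node-injective (trans eq (i.src-≡ w′)) with w″ , refl ← j.wire-onto w′ r = w″ , refl

    part-∘-∼ : {Z : PreCircuit} {Q : X.Node → Set} → Part X Q Y → Part Y (λ _ → ⊤) Z → Part X Q Z
    part-∘-∼ {Q = Q} i j = part-∘ i j (λ {v} _ → Part.node-∈ i v) from
      where
      from : ∀ {v} → Q v → ∃[ v′ ] Part.node i v′ ≡ v × ⊤
      from {v} q with v′ , eq ← Part.node-onto i v q = v′ , eq , tt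

  infix 4 _∼_

  -- The maps of `X ∼ Y` run from `Y` to `X`, against the direction of `X ≅ Y`.
  _∼_ : Circuit → Circuit → Set
  X ∼ Y = Part (Circuit.preCircuit X) (λ _ → ⊤) (Circuit.preCircuit Y)

  ∼-sym : ∀ {X Y} → X ∼ Y → Y ∼ X
  ∼-sym {X} {Y} i = record
    { node           = node′
    ; wire           = wire′
    ; node-injective = λ {u} {v} eq → trans (sym (node-node′ u)) (trans (cong node eq) (node-node′ v))
    ; wire-injective = λ {u} {v} eq → trans (sym (wire-wire′ u)) (trans (cong wire eq) (wire-wire′ v))
    ; node-∈         = λ _ → tt
    ; node-onto      = λ v _ → node v , node-injective (node-node′ (node v))
    ; wire-onto      = λ w _ → wire w , wire′-wire w
    ; kind-≡         = λ v → sym (trans (cong (mapKind wire′) (trans (cong X.kind (sym (node-node′ v))) (kind-≡ (node′ v))))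
                         (trans (mapKind-∘ wire′ wire (Y.kind (node′ v))) (mapKind-id wire′-wire _)))
    ; src-≡          = λ w → node-injective (trans (sym (src-≡ (wire′ w)))
                         (trans (cong X.src (wire-wire′ w)) (sym (node-node′ (X.src w)))))
    ; tgt-⇔          = λ w v → mk⇔
        (λ eq → Equivalence.from (tgt-⇔ _ _) (trans (cong X.tgt (wire-wire′ w)) (trans eq (cong just (sym (node-node′ v))))))
        (λ eq → trans (cong X.tgt (sym (wire-wire′ w))) (trans (Equivalence.to (tgt-⇔ _ _) eq) (cong just (node-node′ v))))
    ; label-≡        = λ w → trans (sym (label-≡ (wire′ w))) (cong X.label (wire-wire′ w))
    }
    where
    module X = Circuit X
    module Y = Circuit Y
    open Part i
    node′ : X.Node → Y.Node
    node′ v = proj₁ (node-onto v tt)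
    wire′ : X.Wire → Y.Wire
    wire′ w = proj₁ (wire-onto w tt)
    node-node′ : ∀ v → node (node′ v) ≡ v
    node-node′ v = proj₂ (node-onto v tt)
    wire-wire′ : ∀ w → wire (wire′ w) ≡ w
    wire-wire′ w = proj₂ (wire-onto w tt)
    wire′-wire : ∀ w → wire′ (wire w) ≡ w
    wire′-wire w = wire-injective (wire-wire′ (wire w))

  ≅⇒∼ : ∀ {X Y} → X ≅ Y → Y ∼ X
  ≅⇒∼ {X} {Y} i = record
    { node           = node
    ; wire           = wire
    ; node-injective = ↔-injective nodes
    ; wire-injective = ↔-injective wires
    ; node-∈         = λ _ → tt
    ; node-onto      = λ v _ → Inverse.from nodes v , Inverse.strictlyInverseˡ nodes v
    ; wire-onto      = λ w _ → Inverse.from wires w , Inverse.strictlyInverseˡ wires w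
    ; kind-≡         = kind-≡
    ; src-≡          = src-≡
    ; tgt-⇔          = λ w v → mk⇔ (λ eq → trans (tgt-≡ w) (cong (Maybe.map node) eq)) (from w v)
    ; label-≡        = label-≡
    }
    where
    module X = Circuit X
    module Y = Circuit Y
    open _≅_ i
    from : ∀ w v → Y.tgt (wire w) ≡ just (node v) → X.tgt w ≡ just v
    from w v eq with X.tgt w | trans (sym (tgt-≡ w)) eq
    ... | just u | p = cong just (↔-injective nodes (just-injective p))

  ∼⇒≅ : ∀ {X Y} (i : Y ∼ X) → Circuit.exits Y ≡ map (Part.wire i) (Circuit.exits X) → X ≅ Y
  ∼⇒≅ {X} {Y} i exits-≡ = record
    { nodes   = mk↔ₛ′ node (λ v → proj₁ (node-onto v tt)) (λ v → proj₂ (node-onto v tt)) (λ v → node-injective (proj₂ (node-onto (node v) tt)))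
    ; wires   = mk↔ₛ′ wire (λ w → proj₁ (wire-onto w tt)) (λ w → proj₂ (wire-onto w tt)) (λ w → wire-injective (proj₂ (wire-onto (wire w) tt)))
    ; kind-≡  = kind-≡
    ; src-≡   = src-≡
    ; tgt-≡   = tgt-≡
    ; label-≡ = label-≡
    ; exits-≡ = exits-≡
    }
    where
    module X = Circuit X
    module Y = Circuit Y
    open Part i
    tgt-≡ : ∀ w → Y.tgt (wire w) ≡ Maybe.map node (X.tgt w)
    tgt-≡ w with X.tgt w in eq
    ... | just v = Equivalence.to (tgt-⇔ w v) eq
    -- `tgt-⇔` speaks only of targets that exist. A wire of `X` without target is an exit, and since
    -- every node of `Y` is in the image, `exit⁻` excludes a target in `Y`.
    ... | nothing with Y.tgt (wire w) in eq′
    ... | nothing = refl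
    ... | just v = contradiction tt (exit⁻ (Equivalence.from (X.exits-complete w) eq) eq′)

  -- Being an exit is determined by the targets, so the two lists have the same elements; neither
  -- has repetitions. Thus `∼` and `≅` differ by a permutation of exits only.
  ∼-exits : ∀ {X Y} (i : Y ∼ X) → Circuit.exits Y ↭ map (Part.wire i) (Circuit.exits X)
  ∼-exits {X} {Y} i = Unique-set⇒↭ Y.exits-unique (Unique.map⁺ wire-injective X.exits-unique) to from
    where
    module X = Circuit X
    module Y = Circuit Y
    open Part i
    to : ∀ {w} → w ∈ Y.exits → w ∈ map wire X.exits
    to {w} p with w′ , refl ← wire-onto w tt = ∈-map⁺ wire (exit⁺ (Equivalence.to (Y.exits-complete w) p))
    from : ∀ {w} → w ∈ map wire X.exits → w ∈ Y.exits
    from p with w , q , refl ← ∈-map⁻ wire p with Y.tgt (wire w) in eq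
    ... | nothing = Equivalence.from (Y.exits-complete _) eq
    ... | just v = contradiction tt (exit⁻ q eq)

  -- Exit orders and the permutation rule

  reorder-∼ : ∀ Y es (p : Circuit.exits Y ↭ es) → reorder Y es p ∼ Y
  reorder-∼ Y es p = record
    { node = id ; wire = id ; node-injective = id ; wire-injective = id
    ; node-∈ = λ _ → tt ; node-onto = λ v _ → v , refl ; wire-onto = λ w _ → w , refl
    ; kind-≡ = λ v → sym (mapKind-id (λ _ → refl) _)
    ; src-≡ = λ _ → refl ; tgt-⇔ = λ _ _ → mk⇔ id id ; label-≡ = λ _ → refl }

  ∼-refl : ∀ X → X ∼ X
  ∼-refl X = part-∘-∼ (∼-sym {reorder X X.exits ↭-refl} {X} i) i
    where
    module X = Circuit X
    i = reorder-∼ X X.exits ↭-refl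

  part-reorder : ∀ {X Q} Y es (p : Circuit.exits Y ↭ es) → Part X Q (Circuit.preCircuit Y) →
                 Part X Q (Circuit.preCircuit (reorder Y es p))
  part-reorder Y es p i = part-∘-∼ i (∼-sym {reorder Y es p} {Y} (reorder-∼ Y es p))

  -- Push `p` forward to the labels and use the result in a `perm` rule: `↭-map-inv` pulls it back
  -- to `es` itself, even when labels repeat. Only the permutation proof `q` may change.
  translate-reorder : ∀ {Γ Δ} (π : ⊢ Γ) {es} (p : Circuit.exits (translate π) ↭ es) → map (Circuit.label (translate π)) es ≡ Δ →
                      Σ[ π′ ∈ ⊢ Δ ] ∃[ q ] translate π′ ≡ reorder (translate π) es q
  translate-reorder {Δ = Δ} π {es} p refl
    with q , eq ← ↭-map-inv-map⁺ (Circuit.label (translate π)) p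
    -- `acted` retraces the definition of `translate` on `perm`; the transport along
    -- `conclusion-translate` made here cancels the one made there.
    = perm (subst (_↭ Δ) (conclusion-translate π) σ) π , q , trans (cong acted (subst-sym-subst (conclusion-translate π))) (cong reordered eq)
    where
    T = translate π
    σ : Circuit.conclusion T ↭ Δ
    σ = map⁺ (Circuit.label T) p
    reordered : (∃[ es ] Δ ≡ map (Circuit.label T) es × Circuit.exits T ↭ es) → Circuit
    reordered (es , _ , order) = reorder T es order
    acted : Circuit.conclusion T ↭ Δ → Circuit
    acted σ = reordered (↭-map-inv (Circuit.label T) σ)

  ∼⇒Sequentializable : ∀ {X Γ} (π : ⊢ Γ) → X ∼ translate π → Sequentializable X
  ∼⇒Sequentializable {X} π i
    with j ← ∼-sym {X} {translate π} i
    with π′ , q , eq ← translate-reorder π (∼-exits {X} {translate π} j) refl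
    = _ , π′ , subst (X ≅_) (sym eq)
        (∼⇒≅ {X} {reorder (translate π) _ q} (part-∘-∼ (reorder-∼ (translate π) _ q) j) refl)

  -- Erasure derivations as trees: the order in which independent circuits of
  -- the set are reduced is irrelevant.
  data Reducible (X : Circuit) : Set₁ where
    reduce : ∀ {N S} → X ⤳[ N ] S → All Reducible S → Reducible X

  -- The surrounding set `T` is arbitrary, so that sibling subtrees can be erased one after the
  -- other.
  erase    : ∀ {X T U} → Reducible X → U ↭ X ∷ T → U ⤳* T
  eraseAll : ∀ {S T} → All Reducible S → T ++ S ⤳* T

  erase (reduce s rs) p = step p s ↭-refl ◅ eraseAll rs
  eraseAll {T = T} [] = subst (_⤳* T) (sym (++-identityʳ T)) ε
  eraseAll {Y ∷ S} {T} (r ∷ rs) = erase r (shift Y T S) ◅◅ eraseAll rs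

  Reducible⇒Erasable : ∀ {X} → Reducible X → Erasable X
  Reducible⇒Erasable r = erase r ↭-refl

  -- The property concerns every circuit of the set. It is vacuous for the final empty set and is
  -- carried backwards: a step replaces one circuit by its residuals, whose trees become the
  -- subtrees of its own.
  ⤳*-Reducible : ∀ {T} → T ⤳* [] → All Reducible T
  ⤳*-Reducible ε = []
  ⤳*-Reducible (step {T′} p s q ◅ rest) with rs ← All-resp-↭ q (⤳*-Reducible rest) =
    All-resp-↭ (↭-sym p) (reduce s (All.++⁻ʳ T′ rs) ∷ All.++⁻ˡ T′ rs)

  -- Residual circuits of a deletion

  module _ (X : Circuit) where

    open Circuit X
    open Erasure X

    ∈-finals⁺ : ∀ {v} → Final v → v ∈ finals
    ∈-finals⁺ (w , refl , eq) = ∈-map⁺ src (Equivalence.from (exits-complete w) eq)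

    ∈-finals⁻ : ∀ {v} → v ∈ finals → Final v
    ∈-finals⁻ p with w , q , refl ← ∈-map⁻ src p = w , refl , Equivalence.to (exits-complete w) q

    ConnectedWithout-∉ : ∀ {ds u v} → u ∉ ds → ConnectedWithout ds u v → v ∉ ds
    ConnectedWithout-∉ u∉ ε                       = u∉
    ConnectedWithout-∉ u∉ (fwd (_ , _ , v∉) ◅ cs) = ConnectedWithout-∉ v∉ cs
    ConnectedWithout-∉ u∉ (bwd (_ , v∉ , _) ◅ cs) = ConnectedWithout-∉ v∉ cs

    deleted-final : ∀ {N} (ready : Ready N) → ∀ {v} → v ∈ deleted ready → Final v
    deleted-final (plus _ f _)              (here refl) = f
    deleted-final (tensor _ _ f _ _ _ _)    (here refl) = f
    deleted-final (par _ _ f _ _ _)         (here refl) = f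
    deleted-final (with′ _ _ _ _ _ _ _ _ _) p           = ∈-finals⁻ p
    deleted-final (axiom f _ _)             (here refl) = f

    ∈-inputs : ∀ {v k w} (wf : WellFormed src tgt label v k) → tgt w ≡ just v → w ∈ inputs src tgt label wf
    ∈-inputs (axiom _ _ _ _ i _ _ _)       = Equivalence.to (i _)
    ∈-inputs (contraction _ _ _ _ i _ _ _) = Equivalence.to (i _)
    ∈-inputs (binary _ _ _ _ _ i _ _)      = Equivalence.to (i _)
    ∈-inputs (plus _ _ _ _ i _ _)          = Equivalence.to (i _)

    module _ {ds : List Node} where

      ∈-residualExits-exit : ∀ {e} → e ∈ exits → src e ∉ ds → e ∈ residualExits ds
      ∈-residualExits-exit {e} p e∉ = ∈-concatMap⁺ (replaceExit ds) (lose p kept)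
        where
        kept : e ∈ replaceExit ds e
        kept with DecMembership._∈?_ _≟ᴺ_ (src e) ds
        ... | yes e∈ = contradiction e∈ e∉
        ... | no  _  = here refl

      ∈-residualExits-input : ∀ {w v} → tgt w ≡ just v → v ∈ ds → Final v → w ∈ residualExits ds
      ∈-residualExits-input {w} eq v∈ (e , refl , exit) =
        ∈-concatMap⁺ (replaceExit ds) (lose (Equivalence.from (exits-complete e) exit) replaced)
        where
        replaced : w ∈ replaceExit ds e
        replaced with DecMembership._∈?_ _≟ᴺ_ (src e) ds
        ... | yes _  = ∈-inputs (wellFormed (src e)) eq
        ... | no  v∉ = contradiction v∈ v∉

      -- `Y` may list its exits in any order, whereas a component lists them along
      -- `residualExits ds`. Each of them occurs there: in `X` it is an exit of a surviving node or
      -- an input of a deleted one, and deleted nodes, being final, have an exit that is replaced by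
      -- their inputs.
      componentCircuit : ∀ {r Y} → (∀ {v} → v ∈ ds → Final v) → r ∉ ds →
                         Part preCircuit (ConnectedWithout ds r) (Circuit.preCircuit Y) →
                         ∃[ Y′ ] IsComponent ds r Y′ × Y′ ∼ Y
      componentCircuit {r} {Y} final r∉ i =
        let es , order , ⊆ = reorder-⊆ _≟ᵂ_ wire wire-injective (residualExits ds) Y.exits-unique residual
        in reorder Y es order , component es order ⊆ , reorder-∼ Y es order
        where
        module Y = Circuit Y
        open Part i
        residual : ∀ {w} → w ∈ Y.exits → wire w ∈ residualExits ds
        residual {w} p with tgt (wire w) in eq
        ... | nothing = ∈-residualExits-exit (Equivalence.from (exits-complete _) eq) (ConnectedWithout-∉ r∉ (src-∈ w))
        ... | just v with DecMembership._∈?_ _≟ᴺ_ v ds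
        ... | yes v∈ = ∈-residualExits-input eq v∈ (final v∈)
        -- A surviving target would lie in the same component by way of this very wire, which then
        -- would not be an exit of `Y`.
        ... | no  v∉ = contradiction
          (src-∈ w ◅◅ return ((wire w , refl , eq) , ConnectedWithout-∉ r∉ (src-∈ w) , v∉)) (exit⁻ p eq)
        component : ∀ es order → map wire es ⊆ residualExits ds → IsComponent ds r (reorder Y es order)
        component es order ⊆ = record
          { node           = node
          ; wire           = wire
          ; node-injective = node-injective
          ; wire-injective = wire-injective
          ; node-image     = λ v → mk⇔ (λ { (v′ , refl) → node-∈ v′ }) (node-onto v)
          ; wire-image     = λ w → mk⇔ (λ { (w′ , refl) → src-∈ w′ }) (wire-onto w)
          ; kind-≡         = kind-≡
          ; src-≡          = src-≡
          ; tgt-⇔          = tgt-⇔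
          ; label-≡        = label-≡
          ; exits-⊆        = ⊆
          }

    -- The actual residuals are reorderings of the given `Ys`; hence reducibility is demanded of
    -- every circuit equal to `Y` up to exit order.
    reduce-into : ∀ {N rs Ys} (ready : Ready N) → Components (deleted ready) rs →
                  Pointwise (λ r Y → Part preCircuit (ConnectedWithout (deleted ready) r) (Circuit.preCircuit Y)) rs Ys →
                  All (λ Y → ∀ {Z} → Z ∼ Y → Reducible Z) Ys → Reducible X
    reduce-into {N} {rs} ready components parts reducible =
      let S , residuals , reducibles = build (Components.surviving components) parts reducible
      in reduce {N = N} {S = S} (record
          { ready = ready ; representatives = rs ; components = components ; residuals = residuals }) reducibles
      where
      ds = deleted ready
      build : ∀ {rs Ys} → All (_∉ ds) rs →
              Pointwise (λ r Y → Part preCircuit (ConnectedWithout ds r) (Circuit.preCircuit Y)) rs Ys →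
              All (λ Y → ∀ {Z} → Z ∼ Y → Reducible Z) Ys →
              ∃[ S ] Pointwise (IsComponent ds) rs S × All Reducible S
      build [] [] [] = [] , [] , []
      build (r∉ ∷ rs∉) (_∷_ {x = r} {y = Y} i is) (h ∷ hs)
        with Z , c , e ← componentCircuit {r = r} {Y = Y} (deleted-final ready) r∉ i | S , cs , hs′ ← build rs∉ is hs
        = Z ∷ S , c ∷ cs , h {Z} e ∷ hs′

  circuit-part : ∀ (Y : Circuit) r → Part (Circuit.preCircuit Y) (Circuit.Connected Y r) (Circuit.preCircuit Y)
  circuit-part Y r = part-⇔ (λ {v} _ → Circuit.connected Y r v) (λ _ → tt) (∼-refl Y)

  -- Components of a disjoint union

  module _ (X Y : Circuit) where

    private
      module X = Circuit X
      module Y = Circuit Y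
      module X⊎Y = PreCircuit (X.preCircuit ⊎ᴾ Y.preCircuit)

    ⊎-connectedˡ⁺ : ∀ u v → X⊎Y.Connected (inj₁ u) (inj₁ v)
    ⊎-connectedˡ⁺ u v = gmap inj₁ (λ { (w , p , q) → inj₁ w , cong inj₁ p , cong (Maybe.map inj₁) q }) (X.connected u v)

    ⊎-connectedʳ⁺ : ∀ u v → X⊎Y.Connected (inj₂ u) (inj₂ v)
    ⊎-connectedʳ⁺ u v = gmap inj₂ (λ { (w , p , q) → inj₂ w , cong inj₂ p , cong (Maybe.map inj₂) q }) (Y.connected u v)

    ⊎-tgtˡ : ∀ w v → X⊎Y.tgt (inj₁ w) ≡ just v → ∃[ v′ ] inj₁ v′ ≡ v × X.tgt w ≡ just v′
    ⊎-tgtˡ w v eq with X.tgt w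
    ⊎-tgtˡ w v refl | just v′ = v′ , refl , refl

    ⊎-tgtʳ : ∀ w v → X⊎Y.tgt (inj₂ w) ≡ just v → ∃[ v′ ] inj₂ v′ ≡ v × Y.tgt w ≡ just v′
    ⊎-tgtʳ w v eq with Y.tgt w
    ⊎-tgtʳ w v refl | just v′ = v′ , refl , refl

    ⊎-joined : ∀ {u v} → X⊎Y.Joined u v → (∃₂ λ u′ v′ → u ≡ inj₁ u′ × v ≡ inj₁ v′) ⊎ (∃₂ λ u′ v′ → u ≡ inj₂ u′ × v ≡ inj₂ v′)
    ⊎-joined (inj₁ w , refl , q) with v , refl , _ ← ⊎-tgtˡ w _ q = inj₁ (_ , v , refl , refl)
    ⊎-joined (inj₂ w , refl , q) with v , refl , _ ← ⊎-tgtʳ w _ q = inj₂ (_ , v , refl , refl)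

    ⊎-connectedˡ⁻ : ∀ {u v} → X⊎Y.Connected (inj₁ u) v → ∃[ v′ ] inj₁ v′ ≡ v
    ⊎-connectedˡ⁻ ε = _ , refl
    ⊎-connectedˡ⁻ (fwd j ◅ js) with inj₁ (_ , _ , refl , refl) ← ⊎-joined j = ⊎-connectedˡ⁻ js
    ⊎-connectedˡ⁻ (bwd j ◅ js) with ⊎-joined j
    ... | inj₁ (_ , _ , refl , refl) = ⊎-connectedˡ⁻ js

    ⊎-connectedʳ⁻ : ∀ {u v} → X⊎Y.Connected (inj₂ u) v → ∃[ v′ ] inj₂ v′ ≡ v
    ⊎-connectedʳ⁻ ε = _ , refl
    ⊎-connectedʳ⁻ (fwd j ◅ js) with inj₂ (_ , _ , refl , refl) ← ⊎-joined j = ⊎-connectedʳ⁻ js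
    ⊎-connectedʳ⁻ (bwd j ◅ js) with ⊎-joined j
    ... | inj₂ (_ , _ , refl , refl) = ⊎-connectedʳ⁻ js

    ⊎-partˡ : ∀ u → Part (X.preCircuit ⊎ᴾ Y.preCircuit) (X⊎Y.Connected (inj₁ u)) X.preCircuit
    ⊎-partˡ u = record
      { node           = inj₁
      ; wire           = inj₁
      ; node-injective = inj₁-injective
      ; wire-injective = inj₁-injective
      ; node-∈         = ⊎-connectedˡ⁺ u
      ; node-onto      = λ _ → ⊎-connectedˡ⁻
      ; wire-onto      = wire-onto
      ; kind-≡         = λ _ → refl
      ; src-≡          = λ _ → refl
      ; tgt-⇔          = λ w v → mk⇔ (cong (Maybe.map inj₁)) (from w v)
      ; label-≡        = λ _ → refl
      }
      where
      wire-onto : ∀ w → X⊎Y.Connected (inj₁ u) (X⊎Y.src w) → ∃[ w′ ] inj₁ w′ ≡ w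
      wire-onto (inj₁ w) _ = w , refl
      wire-onto (inj₂ w) c with () ← ⊎-connectedˡ⁻ c .proj₂
      from : ∀ w v → X⊎Y.tgt (inj₁ w) ≡ just (inj₁ v) → X.tgt w ≡ just v
      from w v eq with _ , refl , p ← ⊎-tgtˡ w _ eq = p

    ⊎-partʳ : ∀ u → Part (X.preCircuit ⊎ᴾ Y.preCircuit) (X⊎Y.Connected (inj₂ u)) Y.preCircuit
    ⊎-partʳ u = record
      { node           = inj₂
      ; wire           = inj₂
      ; node-injective = inj₂-injective
      ; wire-injective = inj₂-injective
      ; node-∈         = ⊎-connectedʳ⁺ u
      ; node-onto      = λ _ → ⊎-connectedʳ⁻
      ; wire-onto      = wire-onto
      ; kind-≡         = λ _ → refl
      ; src-≡          = λ _ → refl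
      ; tgt-⇔          = λ w v → mk⇔ (cong (Maybe.map inj₂)) (from w v)
      ; label-≡        = λ _ → refl
      }
      where
      wire-onto : ∀ w → X⊎Y.Connected (inj₂ u) (X⊎Y.src w) → ∃[ w′ ] inj₂ w′ ≡ w
      wire-onto (inj₂ w) _ = w , refl
      wire-onto (inj₁ w) c with () ← ⊎-connectedʳ⁻ c .proj₂
      from : ∀ w v → X⊎Y.tgt (inj₂ w) ≡ just (inj₂ v) → Y.tgt w ≡ just v
      from w v eq with _ , refl , p ← ⊎-tgtʳ w _ eq = p

  -- Deleting attached nodes gives back the circuit above them

  module Attached
    (X : Circuit) (P : PreCircuit)
    (new : List (NewNode (PreCircuit.Wire P))) (consistent : All (Consistent (PreCircuit.label P)) new)
    (rest : List (PreCircuit.Wire P)) (split : PreCircuit.exits P ↭ rest ++ concatMap newInputs new)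
    (es : List (PreCircuit.Wire P ⊎ Fin (length new))) (order : es ↭ map inj₁ rest ++ map inj₂ (allFin (length new)))
    (i : Part (Circuit.preCircuit X) (λ _ → ⊤) (Attach.attach P new consistent rest split es order))
    where

    private
      module P = PreCircuit P
      module A = Attach P new consistent rest split es order
    open Circuit X
    open Erasure X
    open Part i

    tgt-nothing : ∀ {w} → A.tgt w ≡ nothing → tgt (wire w) ≡ nothing
    tgt-nothing {w} eq with tgt (wire w) in eq′
    ... | nothing = refl
    ... | just v = contradiction tt (exit⁻ (Equivalence.from (PreCircuit.exits-complete A.attach w) eq) eq′)

    new-final : ∀ k → Final (node (inj₂ k))
    new-final k = wire (inj₂ k) , src-≡ (inj₂ k) , tgt-nothing {inj₂ k} refl

    tgt-input : ∀ {w} k → w ∈ A.ins k → tgt (wire (inj₁ w)) ≡ just (node (inj₂ k))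
    tgt-input k p = Equivalence.to (tgt-⇔ _ _) (A.tgt-new k p)

    old : P.Node → Node
    old v = node (inj₁ v)

    old≢new : ∀ {v k} → old v ≢ node (inj₂ k)
    old≢new eq with () ← node-injective eq

    -- `ds` is described by membership alone: it is a singleton for the rules adding one node, but
    -- for `with′` it is `finals`, which need not follow the order of `new`.
    module Deleting (ds : List Node) (new-∈ : ∀ k → node (inj₂ k) ∈ ds) (old-∉ : ∀ v → old v ∉ ds) where

      old-onto : ∀ {v} → v ∉ ds → ∃[ v′ ] old v′ ≡ v
      old-onto {v} v∉ with node-onto v tt
      ... | inj₁ v′ , eq = v′ , eq
      ... | inj₂ k , refl = contradiction (new-∈ k) v∉

      connected⁺ : ∀ {u v} → P.Connected u v → ConnectedWithout ds (old u) (old v)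
      connected⁺ = gmap old λ { {u} {v} (w , refl , q) →
        (wire (inj₁ w) , src-≡ (inj₁ w) , Equivalence.to (tgt-⇔ _ _) (A.tgt-old q)) , old-∉ u , old-∉ v }

      joined⁻ : ∀ {u v} → Joined (old u) (old v) → P.Joined u v
      joined⁻ {u} {v} (w , p , q) with wire-onto w tt
      ... | inj₂ k , refl = contradiction (trans (sym p) (src-≡ (inj₂ k))) old≢new
      ... | inj₁ w′ , refl with refl ← node-injective (trans (sym p) (src-≡ (inj₁ w′))) =
        w′ , refl , A.tgt-old⁻ (Equivalence.from (tgt-⇔ _ _) q)

      -- A path avoiding the new nodes stays on old ones, and attaching neither adds a wire between
      -- old nodes nor redirects one. So the components left by the deletion are those of `P`.
      connected⁻ : ∀ {u v} → ConnectedWithout ds (old u) v → ∃[ v′ ] old v′ ≡ v × P.Connected u v′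
      connected⁻ ε = _ , refl , ε
      connected⁻ (fwd (j , _ , x∉) ◅ c) with x , refl ← old-onto x∉ with v , eq , c′ ← connected⁻ c =
        v , eq , fwd (joined⁻ j) ◅ c′
      connected⁻ (bwd (j , x∉ , _) ◅ c) with x , refl ← old-onto x∉ with v , eq , c′ ← connected⁻ c =
        v , eq , bwd (joined⁻ j) ◅ c′

      old-part : Part preCircuit (_∉ ds) P
      old-part = record
        { node           = old
        ; wire           = wire ∘ inj₁
        ; node-injective = inj₁-injective ∘ node-injective
        ; wire-injective = inj₁-injective ∘ wire-injective
        ; node-∈         = old-∉
        ; node-onto      = λ _ → old-onto
        ; wire-onto      = wire-onto′
        ; kind-≡         = λ v → trans (kind-≡ (inj₁ v)) (mapKind-∘ wire inj₁ (P.kind v))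
        ; src-≡          = src-≡ ∘ inj₁
        ; tgt-⇔          = λ w v → mk⇔ (Equivalence.to (tgt-⇔ _ _) ∘ A.tgt-old) (A.tgt-old⁻ ∘ Equivalence.from (tgt-⇔ _ _))
        ; label-≡        = label-≡ ∘ inj₁
        }
        where
        wire-onto′ : ∀ w → src w ∉ ds → ∃[ w′ ] wire (inj₁ w′) ≡ w
        wire-onto′ w w∉ with wire-onto w tt
        ... | inj₁ w′ , eq = w′ , eq
        ... | inj₂ k , refl = contradiction (subst (_∈ ds) (sym (src-≡ (inj₂ k))) (new-∈ k)) w∉

      old-component : ∀ {r Y} → Part P (P.Connected r) Y → Part preCircuit (ConnectedWithout ds (old r)) Y
      old-component j = part-∘ old-part j connected⁺ connected⁻

  module AttachedOne (X Y : Circuit) (n : NewNode (Circuit.Wire Y)) (consistent : Consistent (Circuit.label Y) n)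
    (ws : List (Circuit.Wire Y)) (eq : Circuit.exits Y ≡ ws ++ newInputs n) (i : X ∼ attachOne Y n consistent ws eq) where

    open Circuit X
    open Erasure X
    open Part i
    open Attached X (Circuit.preCircuit Y) (n ∷ []) (consistent ∷ []) ws
      (↭-reflexive (trans eq (cong (ws ++_) (sym (++-identityʳ _)))))
      (map inj₁ ws ++ inj₂ zero ∷ []) ↭-refl i public

    new-∈ : ∀ k → node (inj₂ k) ∈ node (inj₂ zero) ∷ []
    new-∈ zero = here refl

    old-∉ : ∀ v → old v ∉ node (inj₂ zero) ∷ []
    old-∉ _ (here p) = old≢new p

    open Deleting (node (inj₂ zero) ∷ []) new-∈ old-∉ public

    components : Components (node (inj₂ zero) ∷ []) (old (Circuit.nonEmpty Y) ∷ [])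
    components = record
      { surviving = old-∉ _ ∷ []
      ; distinct  = [] ∷ []
      ; covering  = covering
      }
      where
      covering : ∀ v → v ∉ node (inj₂ zero) ∷ [] → Any (λ r → ConnectedWithout (node (inj₂ zero) ∷ []) r v) (old (Circuit.nonEmpty Y) ∷ [])
      covering v v∉ with v′ , refl ← old-onto v∉ = here (connected⁺ (Circuit.connected Y _ v′))

    component : Part preCircuit (ConnectedWithout (node (inj₂ zero) ∷ []) (old (Circuit.nonEmpty Y))) (Circuit.preCircuit Y)
    component = old-component (circuit-part Y (Circuit.nonEmpty Y))

  -- Translations of proofs are erasable

  parCircuit-reducible : ∀ {X} Y ws a b eq → (∀ {Z} → Z ∼ Y → Reducible Z) → X ∼ parCircuit Y ws a b eq → Reducible X
  parCircuit-reducible {X} Y ws a b eq h i =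
    reduce-into X {Ys = Y ∷ []} (par _ _ (new-final zero) (kind-≡ (inj₂ zero)) _ components) components (component ∷ []) (h ∷ [])
    where
    open Part i
    open AttachedOne X Y (binary par a b) tt ws eq i
    open Erasure X

  plusCircuit-reducible : ∀ {X} Y s B ws a eq → (∀ {Z} → Z ∼ Y → Reducible Z) → X ∼ plusCircuit Y s B ws a eq → Reducible X
  plusCircuit-reducible {X} Y s B ws a eq h i =
    reduce-into X {Ys = Y ∷ []} (plus s (new-final zero) (kind-≡ (inj₂ zero))) components (component ∷ []) (h ∷ [])
    where
    open Part i
    open AttachedOne X Y (plus s a B) tt ws eq i
    open Erasure X

  axiomCircuit-reducible : ∀ {X} P → X ∼ axiomCircuit P → Reducible X
  axiomCircuit-reducible {X} P i =
    reduce-into X {Ys = []} (axiom (wire zero , src-≡ zero , exit) (kind-≡ zero) only)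
      (record { surviving = [] ; distinct = [] ; covering = λ v v∉ → contradiction (here (only v)) v∉ }) [] []
    where
    open Part i
    open Circuit X
    open Erasure X
    only : ∀ v → v ≡ node zero
    only v with zero , refl ← node-onto v tt = refl
    exit : tgt (wire zero) ≡ nothing
    exit with tgt (wire zero) in eq
    ... | nothing = refl
    ... | just v = contradiction tt (exit⁻ (here refl) eq)

  module _ (X Y Z : Circuit)
    (new : List (NewNode (Circuit.Wire Y ⊎ Circuit.Wire Z)))
    (consistent : All (Consistent (PreCircuit.label (Circuit.preCircuit Y ⊎ᴾ Circuit.preCircuit Z))) new)
    (rest : List (Circuit.Wire Y ⊎ Circuit.Wire Z))
    (split : PreCircuit.exits (Circuit.preCircuit Y ⊎ᴾ Circuit.preCircuit Z) ↭ rest ++ concatMap newInputs new)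
    (es : List ((Circuit.Wire Y ⊎ Circuit.Wire Z) ⊎ Fin (length new))) (order : es ↭ map inj₁ rest ++ map inj₂ (allFin (length new)))
    (i : Part (Circuit.preCircuit X) (λ _ → ⊤) (Attach.attach (Circuit.preCircuit Y ⊎ᴾ Circuit.preCircuit Z) new consistent rest split es order))
    where

    open Circuit X
    open Erasure X
    open Part i

    module AttachedTwo = Attached X (Circuit.preCircuit Y ⊎ᴾ Circuit.preCircuit Z) new consistent rest split es order i
    open AttachedTwo

    module DeletingTwo (ds : List Node) (new-∈ : ∀ k → node (inj₂ k) ∈ ds) (old-∉ : ∀ v → old v ∉ ds) where

      open Deleting ds new-∈ old-∉ public

      y₀ z₀ : Node
      y₀ = old (inj₁ (Circuit.nonEmpty Y))
      z₀ = old (inj₂ (Circuit.nonEmpty Z))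

      components : Components ds (y₀ ∷ z₀ ∷ [])
      components = record
        { surviving = old-∉ _ ∷ old-∉ _ ∷ []
        ; distinct  = (separated ∷ []) ∷ [] ∷ []
        ; covering  = covering
        }
        where
        separated : ¬ ConnectedWithout ds y₀ z₀
        separated c with v , eq , c′ ← connected⁻ c
          with refl ← inj₁-injective (node-injective eq)
          with () ← ⊎-connectedˡ⁻ Y Z c′ .proj₂
        covering : ∀ v → v ∉ ds → Any (λ r → ConnectedWithout ds r v) (y₀ ∷ z₀ ∷ [])
        covering v v∉ with old-onto v∉
        ... | inj₁ y , refl = here (connected⁺ (⊎-connectedˡ⁺ Y Z _ y))
        ... | inj₂ z , refl = there (here (connected⁺ (⊎-connectedʳ⁺ Y Z _ z)))

      parts : Pointwise (λ r Y → Part preCircuit (ConnectedWithout ds r) (Circuit.preCircuit Y)) (y₀ ∷ z₀ ∷ []) (Y ∷ Z ∷ [])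
      parts = old-component (⊎-partˡ Y Z _) ∷ old-component (⊎-partʳ Y Z _) ∷ []

  module _ (Y Z : Circuit) where

    private
      module Y = Circuit Y
      module Z = Circuit Z

    tensorCircuit-reducible : ∀ {X} ws a eqY us b eqZ → (∀ {V} → V ∼ Y → Reducible V) → (∀ {V} → V ∼ Z → Reducible V) →
                              X ∼ TensorCircuit.circuit Y Z ws a eqY us b eqZ → Reducible X
    tensorCircuit-reducible {X} ws a eqY us b eqZ hY hZ i =
      reduce-into X {Ys = Y ∷ Z ∷ []} (tensor _ _ (new-final zero) (kind-≡ (inj₂ zero)) _ _ components)
        components parts (hY ∷ hZ ∷ [])
      where
      open Part i
      open Erasure X
      module T = TensorCircuit Y Z ws a eqY us b eqZ
      open AttachedTwo X Y Z (binary tensor (inj₁ a) (inj₂ b) ∷ []) (tt ∷ []) (map inj₁ ws ++ map inj₂ us) T.split T.order T.order-↭ i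
      new-∈ : ∀ k → node (inj₂ k) ∈ node (inj₂ zero) ∷ []
      new-∈ zero = here refl
      old-∉ : ∀ v → old v ∉ node (inj₂ zero) ∷ []
      old-∉ _ (here p) = old≢new p
      open DeletingTwo X Y Z (binary tensor (inj₁ a) (inj₂ b) ∷ []) (tt ∷ []) (map inj₁ ws ++ map inj₂ us) T.split T.order T.order-↭ i
        (node (inj₂ zero) ∷ []) new-∈ old-∉

    -- The second alternative is written as the index by which `withNode` is defined, so that
    -- matching on it identifies the with node among the new nodes.
    lookup-contraction : ∀ (ws : List Y.Wire) (us : List Z.Wire) n k →
      let f = zipWith {C = NewNode (Y.Wire ⊎ Z.Wire)} (λ w u → contraction (inj₁ w) (inj₂ u)) ws us in
      (∃₂ λ a b → lookup (f ++ n ∷ []) k ≡ contraction a b) ⊎ k ≡ Any.index (∈-++⁺ʳ {v = n} f (here refl))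
    lookup-contraction []       us       n zero    = inj₂ refl
    lookup-contraction (w ∷ ws) []       n zero    = inj₂ refl
    lookup-contraction (w ∷ ws) (u ∷ us) n zero    = inj₁ (_ , _ , refl)
    lookup-contraction (w ∷ ws) (u ∷ us) n (suc k) with lookup-contraction ws us n k
    ... | inj₁ p    = inj₁ p
    ... | inj₂ refl = inj₂ refl

    withCircuit-reducible : ∀ {X} ws a eqY us b eqZ same → (∀ {V} → V ∼ Y → Reducible V) → (∀ {V} → V ∼ Z → Reducible V) →
                            X ∼ WithCircuit.circuit Y Z ws a eqY us b eqZ same → Reducible X
    withCircuit-reducible {X} ws a eqY us b eqZ same hY hZ i =
      reduce-into X {Ys = Y ∷ Z ∷ []}
        (with′ _ _ (new-final W.withNode) with-kind others _ _ components inputs-separated)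
        components parts (hY ∷ hZ ∷ [])
      where
      open Circuit X
      open Part i
      open Erasure X
      module W = WithCircuit Y Z ws a eqY us b eqZ same
      open AttachedTwo X Y Z W.new (W.consistent ws us same) [] W.split W.order ↭-refl i

      -- No old wire remains an exit, as `rest` is empty; so the final nodes are exactly the new
      -- ones, and deleting `finals` undoes the rule.
      final⁻ : ∀ {v} → Final v → ∃[ k ] node (inj₂ k) ≡ v
      final⁻ (w , refl , eq) with wire-onto w tt
      ... | w′ , refl with k , _ , refl ← ∈-map⁻ inj₂ (exit⁺ {w′} eq) = k , sym (src-≡ (inj₂ k))

      old-∉ : ∀ v → old v ∉ finals
      old-∉ v p with k , eq ← final⁻ (∈-finals⁻ X p) = old≢new (sym eq)

      open DeletingTwo X Y Z W.new (W.consistent ws us same) [] W.split W.order ↭-refl i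
        finals (λ k → ∈-finals⁺ X (new-final k)) old-∉

      with-kind : kind (node (inj₂ W.withNode)) ≡ binary with′ (wire (inj₁ (inj₁ a))) (wire (inj₁ (inj₂ b)))
      with-kind = trans (kind-≡ (inj₂ W.withNode)) (cong (mapKind wire ∘ newKind inj₁) (sym (lookup-index W.with∈new)))

      others : ∀ M → Final M → M ≢ node (inj₂ W.withNode) → kind M ≡ contraction
      others M f M≢ with k , refl ← final⁻ f with lookup-contraction ws us (binary with′ (inj₁ a) (inj₂ b)) k
      ... | inj₁ (_ , _ , eq) = trans (kind-≡ (inj₂ k)) (cong (mapKind wire ∘ newKind inj₁) eq)
      ... | inj₂ refl         = contradiction refl M≢

      rightInputs : ∀ ws us → All (λ n → ∃[ u ] inj₂ u ∈ newInputs n) (W.contractions ws us ++ binary with′ (inj₁ a) (inj₂ b) ∷ [])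
      rightInputs []       us       = (b , there (here refl)) ∷ []
      rightInputs (w ∷ ws) []       = (b , there (here refl)) ∷ []
      rightInputs (w ∷ ws) (u ∷ us) = (u , there (here refl)) ∷ rightInputs ws us

      inputs-separated : ∀ M → Final M → ∃₂ λ w₁ w₂ → tgt w₁ ≡ just M × tgt w₂ ≡ just M ×
                         ConnectedWithout finals y₀ (src w₁) × ConnectedWithout finals z₀ (src w₂)
      inputs-separated M f with k , refl ← final⁻ f =
        let w , p = All.lookup (W.leftInputs ws us) (∈-lookup k)
            u , q = All.lookup (rightInputs ws us) (∈-lookup k)
        in wire (inj₁ (inj₁ w)) , wire (inj₁ (inj₂ u)) , tgt-input k p , tgt-input k q ,
           subst (ConnectedWithout finals y₀) (sym (src-≡ (inj₁ (inj₁ w)))) (connected⁺ (⊎-connectedˡ⁺ Y Z _ _)) ,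
           subst (ConnectedWithout finals z₀) (sym (src-≡ (inj₁ (inj₂ u)))) (connected⁺ (⊎-connectedʳ⁺ Y Z _ _))

  -- A `perm` rule corresponds to no step at all; the freedom in `X` absorbs it, by composition with
  -- `reorder-∼`.
  translate-reducible : ∀ {Γ X} (π : ⊢ Γ) → X ∼ translate π → Reducible X
  translate-reducible (axiom P) i = axiomCircuit-reducible P i
  translate-reducible (perm {Δ = Δ} σ π) i =
    let es , _ , order = ↭-map-inv (Circuit.label (translate π)) (subst (λ Γ → Γ ↭ Δ) (sym (conclusion-translate π)) σ)
    in translate-reducible π (part-∘-∼ i (reorder-∼ (translate π) es order))
  translate-reducible (par Γ π) i =
    let ws , a , b , eq , _ = lastTwo (translate π) (conclusion-translate π)
    in parCircuit-reducible (translate π) ws a b eq (translate-reducible π) i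
  translate-reducible (plus Γ s B π) i =
    let ws , a , eq , _ = last (translate π) (conclusion-translate π)
    in plusCircuit-reducible (translate π) s B ws a eq (translate-reducible π) i
  translate-reducible (tensor Γ Δ π ρ) i =
    let ws , a , eqX , _ = last (translate π) (conclusion-translate π)
        b , us , eqY , _ = first (translate ρ) (conclusion-translate ρ)
    in tensorCircuit-reducible (translate π) (translate ρ) ws a eqX us b eqY
         (translate-reducible π) (translate-reducible ρ) i
  translate-reducible (with′ Γ π ρ) i =
    let ws , a , eqX , p , _ = last (translate π) (conclusion-translate π)
        us , b , eqY , q , _ = last (translate ρ) (conclusion-translate ρ)
    in withCircuit-reducible (translate π) (translate ρ) ws a eqX us b eqY (trans p (sym q))
         (translate-reducible π) (translate-reducible ρ) i

  -- Rebuilding a circuit from what a deletion leaves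

  mapKind-newKind : (f : B → C) (g : A → B) → ∀ n → mapKind f (newKind g n) ≡ newKind (f ∘ g) n
  mapKind-newKind f g (contraction a b) = refl
  mapKind-newKind f g (binary □ l r)    = refl
  mapKind-newKind f g (plus s a B)      = refl

  firstInput : ∀ (n : NewNode A) → ∃[ w ] w ∈ newInputs n
  firstInput (contraction a b) = a , here refl
  firstInput (binary □ l r)    = l , here refl
  firstInput (plus s a B)      = a , here refl

  -- In X, the exit e leaves a node which plays the role of the new node n.
  record Implements (X : Circuit) {P : PreCircuit} {Q : Circuit.Node X → Set} (i : Part (Circuit.preCircuit X) Q P)
                    (e : Circuit.Wire X) (n : NewNode (PreCircuit.Wire P)) : Set where
    open Circuit X
    open Part i using (wire)
    field
      exit        : tgt e ≡ nothing
      only-output : ∀ {w} → src w ≡ src e → w ≡ e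
      kind-≡      : kind (src e) ≡ newKind wire n
      input⁺      : ∀ {w} → w ∈ newInputs n → tgt (wire w) ≡ just (src e)
      input⁻      : ∀ {w} → tgt (wire w) ≡ just (src e) → w ∈ newInputs n
      label-≡     : label e ≡ newLabel (PreCircuit.label P) n

  -- Converse of `Attached.Deleting`: the part `P` outside `ds` is given, and the deleted nodes are
  -- matched with `new` through their outgoing wires `out`.
  module Reassemble
    (X : Circuit) (ds : List (Circuit.Node X)) (P : PreCircuit) (i : Part (Circuit.preCircuit X) (_∉ ds) P)
    (new : List (NewNode (PreCircuit.Wire P))) (consistent : All (Consistent (PreCircuit.label P)) new)
    (rest : List (PreCircuit.Wire P)) (split : PreCircuit.exits P ↭ rest ++ concatMap newInputs new)
    (es : List (PreCircuit.Wire P ⊎ Fin (length new))) (order : es ↭ map inj₁ rest ++ map inj₂ (allFin (length new)))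
    (out : Fin (length new) → Circuit.Wire X)
    (implements : ∀ k → Implements X i (out k) (lookup new k))
    (out-∈ : ∀ k → Circuit.src X (out k) ∈ ds)
    (out-onto : ∀ {v} → v ∈ ds → ∃[ k ] Circuit.src X (out k) ≡ v)
    where

    open Circuit X
    private
      module P = PreCircuit P
      module A = Attach P new consistent rest split es order
      module i = Part i
      module I k = Implements (implements k)

    node : P.Node ⊎ A.New → Node
    node = [ i.node , src ∘ out ]′

    wire : P.Wire ⊎ A.New → Wire
    wire = [ i.wire , out ]′

    -- Every new node has an input, and a wire has one target. If `j` and `k` stood for the same
    -- node of `X`, an input of the one would be an input of the other, but distinct new nodes share
    -- no inputs.
    out-injective : ∀ {j k} → src (out j) ≡ src (out k) → j ≡ k
    out-injective {j} {k} eq with w , p ← firstInput (lookup new j) =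
      A.separate new A.unique-new j k p (I.input⁻ k (trans (I.input⁺ j p) (cong just eq)))

    node-injective : ∀ {u v} → node u ≡ node v → u ≡ v
    node-injective {inj₁ u} {inj₁ v} eq = cong inj₁ (i.node-injective eq)
    node-injective {inj₁ u} {inj₂ k} eq = contradiction (subst (_∈ ds) (sym eq) (out-∈ k)) (i.node-∈ u)
    node-injective {inj₂ k} {inj₁ v} eq = contradiction (subst (_∈ ds) eq (out-∈ k)) (i.node-∈ v)
    node-injective {inj₂ j} {inj₂ k} eq = cong inj₂ (out-injective eq)

    wire-injective : ∀ {u v} → wire u ≡ wire v → u ≡ v
    wire-injective {inj₁ u} {inj₁ v} eq = cong inj₁ (i.wire-injective eq)
    wire-injective {inj₁ u} {inj₂ k} eq = contradiction (subst (λ w → src w ∈ ds) (sym eq) (out-∈ k)) (i.src-∈ u)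
    wire-injective {inj₂ k} {inj₁ v} eq = contradiction (subst (λ w → src w ∈ ds) eq (out-∈ k)) (i.src-∈ v)
    wire-injective {inj₂ j} {inj₂ k} eq = cong inj₂ (out-injective (cong src eq))

    node-onto : ∀ v → ∃[ v′ ] node v′ ≡ v
    node-onto v with DecMembership._∈?_ _≟ᴺ_ v ds
    ... | yes v∈ with k , eq ← out-onto v∈ = inj₂ k , eq
    ... | no  v∉ with v′ , eq ← i.node-onto v v∉ = inj₁ v′ , eq

    wire-onto : ∀ w → ∃[ w′ ] wire w′ ≡ w
    wire-onto w with DecMembership._∈?_ _≟ᴺ_ (src w) ds
    ... | yes w∈ with k , eq ← out-onto w∈ = inj₂ k , sym (I.only-output k (sym eq))
    ... | no  w∉ with w′ , eq ← i.wire-onto w w∉ = inj₁ w′ , eq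

    src-≡ : ∀ w → src (wire w) ≡ node (A.src w)
    src-≡ (inj₁ w) = i.src-≡ w
    src-≡ (inj₂ k) = refl

    kind-≡ : ∀ v → kind (node v) ≡ mapKind wire (A.kind v)
    kind-≡ (inj₁ v) = trans (i.kind-≡ v) (sym (mapKind-∘ wire inj₁ (P.kind v)))
    kind-≡ (inj₂ k) = trans (I.kind-≡ k) (sym (mapKind-newKind wire inj₁ (lookup new k)))

    tgt⁺ : ∀ w v → A.tgt w ≡ just v → tgt (wire w) ≡ just (node v)
    tgt⁺ (inj₁ w) (inj₁ v) eq = Equivalence.to (i.tgt-⇔ w v) (A.tgt-old⁻ eq)
    tgt⁺ (inj₁ w) (inj₂ k) eq = I.input⁺ k (A.tgt-new⁻ eq)

    tgt⁻ : ∀ w v → tgt (wire w) ≡ just (node v) → A.tgt w ≡ just v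
    tgt⁻ (inj₁ w) (inj₁ v) eq = A.tgt-old (Equivalence.from (i.tgt-⇔ w v) eq)
    tgt⁻ (inj₁ w) (inj₂ k) eq = A.tgt-new k (I.input⁻ k eq)
    tgt⁻ (inj₂ k) v        eq with () ← trans (sym (I.exit k)) eq

    label-≡ : ∀ w → label (wire w) ≡ A.label w
    label-≡ (inj₁ w) = i.label-≡ w
    label-≡ (inj₂ k) = I.label-≡ k

    reassemble : Part preCircuit (λ _ → ⊤) A.attach
    reassemble = record
      { node = node ; wire = wire ; node-injective = node-injective ; wire-injective = wire-injective
      ; node-∈ = λ _ → tt ; node-onto = λ v _ → node-onto v ; wire-onto = λ w _ → wire-onto w
      ; kind-≡ = kind-≡ ; src-≡ = src-≡ ; tgt-⇔ = λ w v → mk⇔ (tgt⁺ w v) (tgt⁻ w v) ; label-≡ = label-≡ }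

  reassembleOne : ∀ X N Y (i : Part (Circuit.preCircuit X) (_∉ N ∷ []) (Circuit.preCircuit Y)) {e n} →
                  Circuit.src X e ≡ N → Implements X i e n → ∀ consistent ws eq → X ∼ attachOne Y n consistent ws eq
  reassembleOne X N Y i {e} {n} refl implements consistent ws eq = reassemble
    where
    implementsAll : ∀ k → Implements X i e (lookup (n ∷ []) k)
    implementsAll zero = implements
    out-onto : ∀ {v} → v ∈ N ∷ [] → ∃[ k ] Circuit.src X e ≡ v
    out-onto (here refl) = zero {0} , refl
    open Reassemble X (N ∷ []) (Circuit.preCircuit Y) i (n ∷ []) (consistent ∷ []) ws
      (↭-reflexive (trans eq (cong (ws ++_) (sym (++-identityʳ _)))))
      (map inj₁ ws ++ inj₂ zero ∷ []) ↭-refl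
      (λ _ → e) implementsAll (λ _ → here refl) out-onto

  module _ (X : Circuit) (Q : Circuit.Node X → Set) where

    open Circuit X

    ∈-image-exits : ∀ {Y} (i : Part preCircuit Q Y) {w v} → Q (src w) → tgt w ≡ just v → ¬ Q v →
                    w ∈ map (Part.wire i) (PreCircuit.exits Y)
    ∈-image-exits i {w} q eq ¬q with w′ , refl ← Part.wire-onto i w q = ∈-map⁺ (Part.wire i) (Part.exit-outside⁺ i eq ¬q)

    -- Unlike `∼`, this records the exit order, because the rules select exits by position.
    Arranged : Sequent → List Wire → Set
    Arranged Δ xs = Σ[ π ∈ ⊢ Δ ] Σ[ i ∈ Part preCircuit Q (Circuit.preCircuit (translate π)) ]
                    map (Part.wire i) (Circuit.exits (translate π)) ≡ xs

    arrange : ∀ {Γ} (π : ⊢ Γ) (i : Part preCircuit Q (Circuit.preCircuit (translate π))) {xs Δ} →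
              map (Part.wire i) (Circuit.exits (translate π)) ↭ xs → map label xs ≡ Δ → Arranged Δ xs
    arrange π i σ refl with es , refl , τ ← ↭-map-inv (Part.wire i) σ
      with π′ , q , eq ← translate-reorder π τ
             (trans (map-cong (sym ∘ Part.label-≡ i) es) (map-∘ es))
      -- `translate π′` equals the reordered circuit only propositionally, so the part and the
      -- statement about its exits are transported together.
      = π′ , subst (λ T → Σ[ i′ ∈ Part preCircuit Q (Circuit.preCircuit T) ] map (Part.wire i′) (Circuit.exits T) ≡ map (Part.wire i) es)
               (sym eq) (part-reorder (translate π) es q i , refl)

  -- From steps to rules: axiom, plus and par

  Sequential : Circuit → Set
  Sequential X = ∃₂ λ Γ (π : ⊢ Γ) → X ∼ translate π

  module _ (X : Circuit) where

    open Circuit X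
    open Erasure X

    component⇒part : ∀ {ds r Y} → IsComponent ds r Y → Part preCircuit (ConnectedWithout ds r) (Circuit.preCircuit Y)
    component⇒part c = record
      { node = node ; wire = wire ; node-injective = node-injective ; wire-injective = wire-injective
      ; node-∈ = λ v → Equivalence.to (node-image _) (v , refl)
      ; node-onto = λ v → Equivalence.from (node-image v) ; wire-onto = λ w → Equivalence.from (wire-image w)
      ; kind-≡ = kind-≡ ; src-≡ = src-≡ ; tgt-⇔ = tgt-⇔ ; label-≡ = label-≡ }
      where open IsComponent c

    -- Indexed by any surviving node: the rules need the component of the source of a given input,
    -- while the representatives of a step are arbitrary.
    SequentialAt : List Node → Node → Set
    SequentialAt ds v = ∃₂ λ Γ (π : ⊢ Γ) → Part preCircuit (ConnectedWithout ds v) (Circuit.preCircuit (translate π))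

    sequentialAt : ∀ {ds rs S v} → Any (λ r → ConnectedWithout ds r v) rs → Pointwise (IsComponent ds) rs S →
                   All Sequential S → SequentialAt ds v
    sequentialAt (here c)  (i ∷ _)  ((Γ , π , e) ∷ _) =
      Γ , π , part-⇔ (symmetric _ c ◅◅_) (c ◅◅_) (part-∘-∼ (component⇒part i) e)
    sequentialAt (there p) (_ ∷ is) (_ ∷ es)          = sequentialAt p is es

    binary-node : ∀ {N □ l r} → kind N ≡ binary □ l r → WellFormed src tgt label N (binary □ l r)
    binary-node {N} eq = subst (WellFormed src tgt label N) eq (wellFormed N)

    -- Follow a path from `v` to `N` and stop at the first arrival. Since the only outgoing wire of
    -- `N` is an exit, the last edge is an input of `N`, and the path before it avoids `N`.
    reach : ∀ {N e} → src e ≡ N → tgt e ≡ nothing → (∀ {w} → src w ≡ N → w ≡ e) →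
            ∀ {v} → v ∉ N ∷ [] → ∃[ w ] tgt w ≡ just N × ConnectedWithout (N ∷ []) v (src w)
    reach {N} {e} e-src e-exit only v∉ = go v∉ (connected _ N)
      where
      go : ∀ {v} → v ∉ N ∷ [] → Connected v N → ∃[ w ] tgt w ≡ just N × ConnectedWithout (N ∷ []) v (src w)
      go v∉ ε = contradiction (here refl) v∉
      go v∉ (_◅_ {j = x} (fwd (w , refl , q)) c) with x ≟ᴺ N
      ... | yes refl = w , q , ε
      ... | no  x≢N with x∉ ← (λ { (here eq) → x≢N eq }) with w′ , q′ , c′ ← go x∉ c =
        w′ , q′ , fwd ((w , refl , q) , v∉ , x∉) ◅ c′
      go v∉ (_◅_ {j = x} (bwd (w , p , q)) c) with x ≟ᴺ N
      -- Arriving against the direction of a wire would mean that `N` has an outgoing wire with a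
      -- target.
      ... | yes refl with refl ← only p with () ← trans (sym e-exit) q
      ... | no  x≢N with x∉ ← (λ { (here eq) → x≢N eq }) with w′ , q′ , c′ ← go x∉ c =
        w′ , q′ , bwd ((w , p , q) , x∉ , v∉) ◅ c′

    input-∉ : ∀ {w N} → tgt w ≡ just N → src w ∉ N ∷ []
    input-∉ {w} eq (here eq′) = tgt≢src w (trans eq (cong just (sym eq′)))

    implements-binary : ∀ {P Q} (i : Part preCircuit Q P) {N □ l r} → kind N ≡ binary □ (Part.wire i l) (Part.wire i r) →
                        (f : Final N) → Implements X i (proj₁ f) (binary □ l r)
    implements-binary {P} i {N} {□} {l} {r} kind-eq (e , refl , exit) with binary-node kind-eq
    ... | binary _ _ _ c l≢r inc out lab with here refl ← Equivalence.to (out e) refl = record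
      { exit        = exit
      ; only-output = λ {w} eq → case-only (Equivalence.to (out w) eq)
      ; kind-≡      = kind-eq
      ; input⁺      = input⁺
      ; input⁻      = λ {w} eq → input⁻ (Equivalence.to (inc _) eq)
      ; label-≡     = trans lab (cong₂ (connective □) (label-≡ l) (label-≡ r))
      }
      where
      open Part i using (wire; wire-injective; label-≡)
      case-only : ∀ {w} → w ∈ e ∷ [] → w ≡ e
      case-only (here eq) = eq
      input⁺ : ∀ {w} → w ∈ l ∷ r ∷ [] → tgt (wire w) ≡ just (src e)
      input⁺ (here refl)         = Equivalence.from (inc _) (here refl)
      input⁺ (there (here refl)) = Equivalence.from (inc _) (there (here refl))
      input⁻ : ∀ {w} → wire w ∈ wire l ∷ wire r ∷ [] → w ∈ l ∷ r ∷ []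
      input⁻ (here eq)         = here (wire-injective eq)
      input⁻ (there (here eq)) = there (here (wire-injective eq))

    sequential-axiom : ∀ {N} → kind N ≡ axiom → (∀ M → M ≡ N) → Sequential X
    sequential-axiom {N} kind-eq only with subst (WellFormed src tgt label N) kind-eq (wellFormed N)
    ... | axiom P a b a≢b inc out la lb = _ , axiom P , record
      { node           = λ _ → N
      ; wire           = wire
      ; node-injective = λ { {zero} {zero} _ → refl }
      ; wire-injective = wire-injective
      ; node-∈         = λ _ → tt
      ; node-onto      = λ v _ → zero , sym (only v)
      ; wire-onto      = λ w _ → wire-onto w (Equivalence.to (out w) (only _))
      ; kind-≡         = λ _ → kind-eq
      ; src-≡          = λ _ → only _
      -- A target could only be the single node, which is already the source of the wire.
      ; tgt-⇔          = λ w v → mk⇔ (λ ()) (λ eq → contradiction (trans eq (cong just (sym (only _)))) (tgt≢src (wire w)))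
      ; label-≡        = λ { zero → la ; (suc zero) → lb }
      }
      where
      wire : Fin 2 → Wire
      wire zero       = a
      wire (suc zero) = b
      wire-injective : ∀ {u v} → wire u ≡ wire v → u ≡ v
      wire-injective {zero}     {zero}     eq = refl
      wire-injective {zero}     {suc zero} eq = contradiction eq a≢b
      wire-injective {suc zero} {zero}     eq = contradiction (sym eq) a≢b
      wire-injective {suc zero} {suc zero} eq = refl
      wire-onto : ∀ w → w ∈ a ∷ b ∷ [] → ∃[ k ] wire k ≡ w
      wire-onto w (here refl)         = zero , refl
      wire-onto w (there (here refl)) = suc zero , refl

    -- Readiness of a plus node does not say that the rest is connected. This comes from `reach`:
    -- `N` has a single input, so every surviving node is connected to its source.
    sequential-plus : ∀ {N s} → Final N → kind N ≡ plus s → (∀ {v} → v ∉ N ∷ [] → SequentialAt (N ∷ []) v) → Sequential X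
    sequential-plus {N} {s} (e , refl , exit) kind-eq at with subst (WellFormed src tgt label N) kind-eq (wellFormed N)
    ... | plus _ a c B inc out lab with here refl ← Equivalence.to (out e) refl = moveInput (at (input-∉ a-tgt))
      where
      Q : Node → Set
      Q = _∉ N ∷ []
      case-only : ∀ {w} → w ∈ e ∷ [] → w ≡ e
      case-only (here eq) = eq
      case-input : ∀ {w} → w ∈ a ∷ [] → w ≡ a
      case-input (here eq) = eq
      a-tgt : tgt a ≡ just N
      a-tgt = Equivalence.from (inc a) (here refl)
      covered : ∀ {v} → v ∉ N ∷ [] → ConnectedWithout (N ∷ []) (src a) v
      covered v∉ with w , eq , c ← reach refl exit (λ {w} eq → case-only (Equivalence.to (out w) eq)) v∉
        with refl ← case-input (Equivalence.to (inc w) eq) = symmetric _ c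
      implements : ∀ {P} (i : Part preCircuit Q P) {a′} → Part.wire i a′ ≡ a → Implements X i e (plus s a′ B)
      implements i {a′} a′≡a = record
        { exit        = exit
        ; only-output = λ {w} eq → case-only (Equivalence.to (out w) eq)
        ; kind-≡      = kind-eq
        ; input⁺      = λ { (here refl) → trans (cong tgt a′≡a) a-tgt }
        ; input⁻      = λ eq → here (Part.wire-injective i (trans (case-input (Equivalence.to (inc _) eq)) (sym a′≡a)))
        ; label-≡     = trans lab (cong (λ A → plusFormula s A B) (trans (cong label (sym a′≡a)) (Part.label-≡ i a′)))
        }
      -- Stated for every decomposition of the exits, as the one inside `translate` is whatever
      -- `last` returns; comparing last elements shows that its final wire lies over `a`.
      recognise : ∀ T (i : Part preCircuit Q (Circuit.preCircuit T)) xs → map (Part.wire i) (Circuit.exits T) ≡ xs ++ a ∷ [] →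
                  ∀ ws a′ eq → X ∼ plusCircuit T s B ws a′ eq
      recognise T i xs eq ws a′ eq′ = reassembleOne X N T i refl
        (implements i (∷ʳ-injectiveʳ (map wire ws) xs
          (trans (sym (map-++ wire ws _)) (trans (cong (map wire) (sym eq′)) eq)))) tt ws eq′
        where open Part i using (wire)
      conclude : ∀ xs → Arranged X Q (map label xs ++ label a ∷ []) (xs ++ a ∷ []) → Sequential X
      conclude xs (π , i , eq) =
        let ws , a′ , eq′ , _ = last (translate π) (conclusion-translate π)
        in _ , plus (map label xs) s B π , recognise (translate π) i xs eq ws a′ eq′
      moveInput : SequentialAt (N ∷ []) (src a) → Sequential X
      moveInput (Γ , π , i) with j ← part-⇔ (ConnectedWithout-∉ X (input-∉ a-tgt)) covered i
        with xs , σ ← ↭-to-back (∈-image-exits X Q j (input-∉ a-tgt) a-tgt (λ N∉ → N∉ (here refl)))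
        = conclude xs (arrange X Q π j σ (map-++ label xs (a ∷ [])))

    sequential-par : ∀ {N l r x} → Final N → kind N ≡ binary par l r → Components (N ∷ []) (x ∷ []) →
                     (∀ {v} → v ∉ N ∷ [] → SequentialAt (N ∷ []) v) → Sequential X
    sequential-par {N} {l} {r} {x} f kind-eq components at with binary-node kind-eq
    ... | binary _ _ _ c l≢r inc out lab = moveInputs (at x∉)
      where
      open Components components
      Q : Node → Set
      Q = _∉ N ∷ []
      l-tgt : tgt l ≡ just N
      l-tgt = Equivalence.from (inc l) (here refl)
      r-tgt : tgt r ≡ just N
      r-tgt = Equivalence.from (inc r) (there (here refl))
      x∉ : x ∉ N ∷ []
      x∉ = All.head surviving
      covered : ∀ {v} → v ∉ N ∷ [] → ConnectedWithout (N ∷ []) x v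
      covered v∉ with here c ← covering _ v∉ = c
      recognise : ∀ T (i : Part preCircuit Q (Circuit.preCircuit T)) xs → map (Part.wire i) (Circuit.exits T) ≡ xs ++ l ∷ r ∷ [] →
                  ∀ ws a b eq → X ∼ parCircuit T ws a b eq
      recognise T i xs eq ws a b eq′ =
        let a≡l , b≡r = ∷ʳ₂-injective (map wire ws) xs
                          (trans (sym (map-++ wire ws _)) (trans (cong (map wire) (sym eq′)) eq))
        in reassembleOne X N T i (proj₁ (proj₂ f))
             (implements-binary i (trans kind-eq (cong₂ (binary par) (sym a≡l) (sym b≡r))) f) tt ws eq′
        where open Part i using (wire)
      conclude : ∀ xs → Arranged X Q (map label xs ++ label l ∷ label r ∷ []) (xs ++ l ∷ r ∷ []) → Sequential X
      conclude xs (π , i , eq) =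
        let ws , a , b , eq′ , _ = lastTwo (translate π) (conclusion-translate π)
        in _ , par (map label xs) π , recognise (translate π) i xs eq ws a b eq′
      moveInputs : SequentialAt (N ∷ []) x → Sequential X
      moveInputs (Γ , π , i) with j ← part-⇔ (ConnectedWithout-∉ X x∉) covered i
        with xs , σ ← ↭-to-back₂ (∈-image-exits X Q j (input-∉ l-tgt) l-tgt (λ N∉ → N∉ (here refl)))
                                 (∈-image-exits X Q j (input-∉ r-tgt) r-tgt (λ N∉ → N∉ (here refl))) l≢r
        = conclude xs (arrange X Q π j σ (map-++ label xs (l ∷ r ∷ [])))

  -- From steps to rules: tensor

  module _ (X : Circuit) where

    open Circuit X
    open Erasure X

    module _ {ds y₁ y₂} (separated : ¬ ConnectedWithout ds y₁ y₂) (y₁∉ : y₁ ∉ ds) (y₂∉ : y₂ ∉ ds)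
             (covered : ∀ {v} → v ∉ ds → ConnectedWithout ds y₁ v ⊎ ConnectedWithout ds y₂ v) where

      -- A wire of `X` from one component to the other would connect them, so the targets agree with
      -- those in the disjoint union; `covered` ensures that nothing surviving is left out.
      part-⊎ : ∀ {Y₁ Y₂} → Part preCircuit (ConnectedWithout ds y₁) (Circuit.preCircuit Y₁) →
               Part preCircuit (ConnectedWithout ds y₂) (Circuit.preCircuit Y₂) →
               Part preCircuit (_∉ ds) (Circuit.preCircuit Y₁ ⊎ᴾ Circuit.preCircuit Y₂)
      part-⊎ {Y₁} {Y₂} i₁ i₂ = record
        { node           = node
        ; wire           = wire
        ; node-injective = node-injective
        ; wire-injective = wire-injective
        ; node-∈         = node-∈
        ; node-onto      = node-onto
        ; wire-onto      = wire-onto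
        ; kind-≡         = kind-≡
        ; src-≡          = λ { (inj₁ w) → i₁.src-≡ w ; (inj₂ w) → i₂.src-≡ w }
        ; tgt-⇔          = λ w v → mk⇔ (tgt⁺ w v) (tgt⁻ w v)
        ; label-≡        = λ { (inj₁ w) → i₁.label-≡ w ; (inj₂ w) → i₂.label-≡ w }
        }
        where
        module Y₁ = Circuit Y₁
        module Y₂ = Circuit Y₂
        module Y = PreCircuit (Y₁.preCircuit ⊎ᴾ Y₂.preCircuit)
        module i₁ = Part i₁
        module i₂ = Part i₂
        node : Y.Node → Node
        node = [ i₁.node , i₂.node ]′
        wire : Y.Wire → Wire
        wire = [ i₁.wire , i₂.wire ]′
        disjoint : ∀ {u v} → ConnectedWithout ds y₁ u → ConnectedWithout ds y₂ v → u ≢ v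
        disjoint c₁ c₂ refl = separated (c₁ ◅◅ symmetric _ c₂)
        node-injective : ∀ {u v} → node u ≡ node v → u ≡ v
        node-injective {inj₁ u} {inj₁ v} eq = cong inj₁ (i₁.node-injective eq)
        node-injective {inj₁ u} {inj₂ v} eq = contradiction eq (disjoint (i₁.node-∈ u) (i₂.node-∈ v))
        node-injective {inj₂ u} {inj₁ v} eq = contradiction (sym eq) (disjoint (i₁.node-∈ v) (i₂.node-∈ u))
        node-injective {inj₂ u} {inj₂ v} eq = cong inj₂ (i₂.node-injective eq)
        wire-injective : ∀ {u v} → wire u ≡ wire v → u ≡ v
        wire-injective {inj₁ u} {inj₁ v} eq = cong inj₁ (i₁.wire-injective eq)
        wire-injective {inj₁ u} {inj₂ v} eq = contradiction (cong src eq) (disjoint (i₁.src-∈ u) (i₂.src-∈ v))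
        wire-injective {inj₂ u} {inj₁ v} eq = contradiction (cong src (sym eq)) (disjoint (i₁.src-∈ v) (i₂.src-∈ u))
        wire-injective {inj₂ u} {inj₂ v} eq = cong inj₂ (i₂.wire-injective eq)
        node-∈ : ∀ v → node v ∉ ds
        node-∈ (inj₁ v) = ConnectedWithout-∉ X y₁∉ (i₁.node-∈ v)
        node-∈ (inj₂ v) = ConnectedWithout-∉ X y₂∉ (i₂.node-∈ v)
        node-onto : ∀ v → v ∉ ds → ∃[ v′ ] node v′ ≡ v
        node-onto v v∉ with covered v∉
        ... | inj₁ c with v′ , eq ← i₁.node-onto v c = inj₁ v′ , eq
        ... | inj₂ c with v′ , eq ← i₂.node-onto v c = inj₂ v′ , eq
        wire-onto : ∀ w → src w ∉ ds → ∃[ w′ ] wire w′ ≡ w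
        wire-onto w w∉ with covered w∉
        ... | inj₁ c with w′ , eq ← i₁.wire-onto w c = inj₁ w′ , eq
        ... | inj₂ c with w′ , eq ← i₂.wire-onto w c = inj₂ w′ , eq
        kind-≡ : ∀ v → kind (node v) ≡ mapKind wire (Y.kind v)
        kind-≡ (inj₁ v) = trans (i₁.kind-≡ v) (sym (mapKind-∘ wire inj₁ (Y₁.kind v)))
        kind-≡ (inj₂ v) = trans (i₂.kind-≡ v) (sym (mapKind-∘ wire inj₂ (Y₂.kind v)))
        tgt⁺ : ∀ w v → Y.tgt w ≡ just v → tgt (wire w) ≡ just (node v)
        tgt⁺ (inj₁ w) v eq with v′ , refl , p ← ⊎-tgtˡ Y₁ Y₂ w v eq = Equivalence.to (i₁.tgt-⇔ w v′) p
        tgt⁺ (inj₂ w) v eq with v′ , refl , p ← ⊎-tgtʳ Y₁ Y₂ w v eq = Equivalence.to (i₂.tgt-⇔ w v′) p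
        edge : ∀ {w v} → v ∉ ds → src w ∉ ds → tgt w ≡ just v → ConnectedWithout ds (src w) v
        edge v∉ w∉ eq = return ((_ , refl , eq) , w∉ , v∉)
        tgt⁻ : ∀ w v → tgt (wire w) ≡ just (node v) → Y.tgt w ≡ just v
        tgt⁻ (inj₁ w) (inj₁ v) eq = cong (Maybe.map inj₁) (Equivalence.from (i₁.tgt-⇔ w v) eq)
        tgt⁻ (inj₂ w) (inj₂ v) eq = cong (Maybe.map inj₂) (Equivalence.from (i₂.tgt-⇔ w v) eq)
        tgt⁻ (inj₁ w) (inj₂ v) eq = contradiction refl
          (disjoint (i₁.src-∈ w ◅◅ edge (node-∈ (inj₂ v)) (ConnectedWithout-∉ X y₁∉ (i₁.src-∈ w)) eq) (i₂.node-∈ v))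
        tgt⁻ (inj₂ w) (inj₁ v) eq = contradiction refl
          (disjoint (i₁.node-∈ v) (i₂.src-∈ w ◅◅ edge (node-∈ (inj₁ v)) (ConnectedWithout-∉ X y₂∉ (i₂.src-∈ w)) eq))

    -- The representatives given by readiness are unrelated to the inputs of `N`. By `reach`, the
    -- components of `src l` and `src r` cover what is left, and as there are two components these
    -- are they. This decides which component is the left premise.
    sequential-tensor : ∀ {N l r x₁ x₂} → Final N → kind N ≡ binary tensor l r → Components (N ∷ []) (x₁ ∷ x₂ ∷ []) →
                        (∀ {v} → v ∉ N ∷ [] → SequentialAt X (N ∷ []) v) → Sequential X
    sequential-tensor {N} {l} {r} {x₁} {x₂} f@(e , e-src , exit) kind-eq components at with binary-node X kind-eq
    ... | binary _ _ _ c l≢r inc out lab with here refl ← Equivalence.to (out e) e-src =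
      moveInputs (at (input-∉ X l-tgt)) (at (input-∉ X r-tgt))
      where
      open Components components
      Q₁ Q₂ : Node → Set
      Q₁ = ConnectedWithout (N ∷ []) (src l)
      Q₂ = ConnectedWithout (N ∷ []) (src r)
      l-tgt : tgt l ≡ just N
      l-tgt = Equivalence.from (inc l) (here refl)
      r-tgt : tgt r ≡ just N
      r-tgt = Equivalence.from (inc r) (there (here refl))
      case-only : ∀ {w} → w ∈ e ∷ [] → w ≡ e
      case-only (here eq) = eq
      covered : ∀ {v} → v ∉ N ∷ [] → Q₁ v ⊎ Q₂ v
      covered v∉ with reach X e-src exit (λ {w} eq → case-only (Equivalence.to (out w) eq)) v∉
      ... | w , eq , c with Equivalence.to (inc w) eq
      ... | here refl         = inj₁ (symmetric _ c)
      ... | there (here refl) = inj₂ (symmetric _ c)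
      -- If the two inputs were connected, so would be all remaining nodes.
      separated : ¬ ConnectedWithout (N ∷ []) (src l) (src r)
      separated c with surviving | distinct
      ... | x₁∉ ∷ x₂∉ ∷ [] | (¬c ∷ []) ∷ _ = ¬c (symmetric _ (from-l x₁∉) ◅◅ from-l x₂∉)
        where
        from-l : ∀ {v} → v ∉ N ∷ [] → Q₁ v
        from-l v∉ with covered v∉
        ... | inj₁ c′ = c′
        ... | inj₂ c′ = c ◅◅ c′
      recognise : ∀ T₁ T₂ (i₁ : Part preCircuit Q₁ (Circuit.preCircuit T₁)) (i₂ : Part preCircuit Q₂ (Circuit.preCircuit T₂)) xs ys →
                  map (Part.wire i₁) (Circuit.exits T₁) ≡ xs ++ l ∷ [] → map (Part.wire i₂) (Circuit.exits T₂) ≡ r ∷ ys →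
                  ∀ ws a eqX us b eqY → X ∼ TensorCircuit.circuit T₁ T₂ ws a eqX us b eqY
      recognise T₁ T₂ i₁ i₂ xs ys eq₁ eq₂ ws a eqX us b eqY = reassemble
        where
        module T = TensorCircuit T₁ T₂ ws a eqX us b eqY
        i = part-⊎ separated (input-∉ X l-tgt) (input-∉ X r-tgt) covered {T₁} {T₂} i₁ i₂
        a≡l : Part.wire i₁ a ≡ l
        a≡l = ∷ʳ-injectiveʳ (map (Part.wire i₁) ws) xs
                (trans (sym (map-++ (Part.wire i₁) ws _)) (trans (cong (map (Part.wire i₁)) (sym eqX)) eq₁))
        b≡r : Part.wire i₂ b ≡ r
        b≡r = ∷-injectiveˡ (trans (cong (map (Part.wire i₂)) (sym eqY)) eq₂)
        implements : ∀ k → Implements X i e (lookup (binary tensor (inj₁ a) (inj₂ b) ∷ []) k)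
        implements zero = implements-binary X i (trans kind-eq (cong₂ (binary tensor) (sym a≡l) (sym b≡r))) f
        out-onto : ∀ {v} → v ∈ N ∷ [] → ∃[ k ] src e ≡ v
        out-onto (here eq) = zero {0} , trans e-src (sym eq)
        open Reassemble X (N ∷ []) (Circuit.preCircuit T₁ ⊎ᴾ Circuit.preCircuit T₂) i
          (binary tensor (inj₁ a) (inj₂ b) ∷ []) (tt ∷ []) (map inj₁ ws ++ map inj₂ us) T.split T.order T.order-↭
          (λ _ → e) implements (λ _ → here e-src) out-onto
      conclude : ∀ xs ys → Arranged X Q₁ (map label xs ++ label l ∷ []) (xs ++ l ∷ []) →
                 Arranged X Q₂ (label r ∷ map label ys) (r ∷ ys) → Sequential X
      conclude xs ys (π , i₁ , eq₁) (ρ , i₂ , eq₂) =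
        let ws , a , eqX , _ = last (translate π) (conclusion-translate π)
            b , us , eqY , _ = first (translate ρ) (conclusion-translate ρ)
        in _ , tensor (map label xs) (map label ys) π ρ ,
           recognise (translate π) (translate ρ) i₁ i₂ xs ys eq₁ eq₂ ws a eqX us b eqY
      outside : ∀ {w} → tgt w ≡ just N → ¬ ConnectedWithout (N ∷ []) (src w) N
      outside eq c = ConnectedWithout-∉ X (input-∉ X eq) c (here refl)
      moveInputs : SequentialAt X (N ∷ []) (src l) → SequentialAt X (N ∷ []) (src r) → Sequential X
      moveInputs (Γ , π , i₁) (Δ , ρ , i₂)
        with xs , σ ← ↭-to-back (∈-image-exits X Q₁ i₁ ε l-tgt (outside l-tgt))
        with ys , τ ← ↭-to-front (∈-image-exits X Q₂ i₂ ε r-tgt (outside r-tgt))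
        = conclude xs ys (arrange X Q₁ π i₁ σ (map-++ label xs (l ∷ []))) (arrange X Q₂ ρ i₂ τ refl)

  -- From steps to rules: with and its contractions

  module _ (X : Circuit) where

    open Circuit X
    open Erasure X

    -- All final nodes are deleted, so no exit of the component is an exit of `X`: each is an input
    -- of a final node. Every final node has just one input in the component, which `g` picks out
    -- through the exit of that node.
    image-exits : ∀ {Y y} → y ∉ finals → (g : Wire → Wire) →
                  (∀ {e} → e ∈ exits → tgt (g e) ≡ just (src e) × ConnectedWithout finals y (src (g e))) →
                  (∀ {e w} → e ∈ exits → tgt w ≡ just (src e) → ConnectedWithout finals y (src w) → w ≡ g e) →
                  (∀ {e w} → e ∈ exits → src w ≡ src e → w ≡ e) →
                  (i : Part preCircuit (ConnectedWithout finals y) Y) → map (Part.wire i) (PreCircuit.exits Y) ↭ map g exits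
    image-exits {Y} {y} y∉ g g-input g-only output-only i = Unique-set⇒↭
      (Unique.map⁺ wire-injective Y.exits-unique) (Unique-map-on g g-injective exits-unique) to from
      where
      module Y = PreCircuit Y
      open Part i
      Q : Node → Set
      Q = ConnectedWithout finals y
      g-injective : ∀ {e e′} → e ∈ exits → e′ ∈ exits → g e ≡ g e′ → e ≡ e′
      g-injective p q eq = output-only q (just-injective (trans (sym (proj₁ (g-input p))) (trans (cong tgt eq) (proj₁ (g-input q)))))
      to : ∀ {w} → w ∈ map wire Y.exits → w ∈ map g exits
      to p with w , q , refl ← ∈-map⁻ wire p with tgt (wire w) in eq
      ... | nothing = contradiction (∈-map⁺ src (Equivalence.from (exits-complete _) eq)) (ConnectedWithout-∉ X y∉ (src-∈ w))
      ... | just v with DecMembership._∈?_ _≟ᴺ_ v finals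
      ... | no v∉ = contradiction (src-∈ w ◅◅ return ((_ , refl , eq) , ConnectedWithout-∉ X y∉ (src-∈ w) , v∉)) (exit⁻ q eq)
      ... | yes v∈ with e , e∈ , refl ← ∈-map⁻ src v∈ = subst (_∈ map g exits) (sym (g-only e∈ eq (src-∈ w))) (∈-map⁺ g e∈)
      from : ∀ {w} → w ∈ map g exits → w ∈ map wire Y.exits
      from p with e , e∈ , refl ← ∈-map⁻ g p with eq , q ← g-input e∈ =
        ∈-image-exits X Q i q eq (λ c → ConnectedWithout-∉ X y∉ c (∈-map⁺ src e∈))

    -- `y₁` represents the component of the left input, which becomes the left premise. Each exit of
    -- `X` determines a pair of inputs of its source, one in each component. Both premises order
    -- their exits along one enumeration of the exits of `X`, with the exit of `N` moved to the end,
    -- so exits in equal positions before the last meet in a contraction node.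
    sequential-with : ∀ {N l r y₁ y₂} → Final N → kind N ≡ binary with′ l r →
                      (∀ M → Final M → M ≢ N → kind M ≡ contraction) →
                      ¬ ConnectedWithout finals y₁ y₂ → y₁ ∉ finals → y₂ ∉ finals →
                      (∀ {v} → v ∉ finals → ConnectedWithout finals y₁ v ⊎ ConnectedWithout finals y₂ v) →
                      (∀ M → Final M → ∃₂ λ w₁ w₂ → tgt w₁ ≡ just M × tgt w₂ ≡ just M ×
                         ConnectedWithout finals y₁ (src w₁) × ConnectedWithout finals y₂ (src w₂)) →
                      ConnectedWithout finals y₁ (src l) → ConnectedWithout finals y₂ (src r) →
                      SequentialAt X finals y₁ → SequentialAt X finals y₂ → Sequential X
    sequential-with {N} {l} {r} {y₁} {y₂} f@(e₀ , e₀-src , e₀-exit) kind-eq others separated y₁∉ y₂∉ covered inputs-separated l∈ r∈ =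
      moveInputs (↭-to-back e₀∈)
      where
      Q₁ Q₂ : Node → Set
      Q₁ = ConnectedWithout finals y₁
      Q₂ = ConnectedWithout finals y₂

      e₀∈ : e₀ ∈ exits
      e₀∈ = Equivalence.from (exits-complete e₀) e₀-exit

      final : ∀ {e} → e ∈ exits → Final (src e)
      final e∈ = _ , refl , Equivalence.to (exits-complete _) e∈

      disjoint : ∀ {u v} → Q₁ u → Q₂ v → u ≢ v
      disjoint c₁ c₂ refl = separated (c₁ ◅◅ symmetric _ c₂)

      -- Outside the exits the value is irrelevant.
      inputPair : Wire → Wire × Wire
      inputPair e with DecMembership._∈?_ _≟ᵂ_ e exits
      ... | yes e∈ = let w₁ , w₂ , _ = inputs-separated (src e) (final e∈) in w₁ , w₂
      ... | no  _  = e , e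

      leftInput rightInput : Wire → Wire
      leftInput  e = proj₁ (inputPair e)
      rightInput e = proj₂ (inputPair e)

      input-spec : ∀ {e} → e ∈ exits → (tgt (leftInput e) ≡ just (src e) × Q₁ (src (leftInput e))) ×
                                       (tgt (rightInput e) ≡ just (src e) × Q₂ (src (rightInput e)))
      input-spec {e} e∈ with DecMembership._∈?_ _≟ᵂ_ e exits
      ... | yes e∈′ = let _ , _ , p , q , c , d = inputs-separated (src e) (final e∈′) in (p , c) , (q , d)
      ... | no  e∉  = contradiction e∈ e∉

      twoInputs : ∀ M → Final M → ∃[ a ] ∃[ b ] ∃[ c ] Incoming src tgt label M (a ∷ b ∷ []) × Outgoing src tgt label M (c ∷ [])
      twoInputs M fM with M ≟ᴺ N
      ... | yes refl with binary _ _ _ _ _ inc out _ ← binary-node X kind-eq = _ , _ , _ , inc , out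
      ... | no  M≢N with contraction _ _ _ _ inc out _ _ ← subst (WellFormed src tgt label M) (others M fM M≢N) (wellFormed M)
        = _ , _ , _ , inc , out

      output-only : ∀ {e w} → e ∈ exits → src w ≡ src e → w ≡ e
      output-only {e} {w} e∈ eq with _ , _ , c , _ , out ← twoInputs (src e) (final e∈)
        with here refl ← Equivalence.to (out e) refl | here refl ← Equivalence.to (out w) eq = refl

      input-cases : ∀ {e w} → e ∈ exits → tgt w ≡ just (src e) → w ≡ leftInput e ⊎ w ≡ rightInput e
      input-cases {e} {w} e∈ eq with (p , c) , (q , d) ← input-spec e∈ | _ , _ , _ , inc , _ ← twoInputs (src e) (final e∈) =
        -- The two chosen inputs have sources in different components; being distinct, they exhaust
        -- the inputs of the node.
        pair-∈ (Equivalence.to (inc _) p) (Equivalence.to (inc _) q) (disjoint c d ∘ cong src) (Equivalence.to (inc w) eq)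

      left-only : ∀ {e w} → e ∈ exits → tgt w ≡ just (src e) → Q₁ (src w) → w ≡ leftInput e
      left-only e∈ eq c with input-cases e∈ eq
      ... | inj₁ p    = p
      ... | inj₂ refl = contradiction refl (disjoint c (proj₂ (proj₂ (input-spec e∈))))

      right-only : ∀ {e w} → e ∈ exits → tgt w ≡ just (src e) → Q₂ (src w) → w ≡ rightInput e
      right-only e∈ eq d with input-cases e∈ eq
      ... | inj₁ refl = contradiction refl (disjoint (proj₂ (proj₁ (input-spec e∈))) d)
      ... | inj₂ p    = p

      left-e₀ : leftInput e₀ ≡ l
      left-e₀ with binary _ _ _ _ _ inc _ _ ← binary-node X kind-eq =
        sym (left-only e₀∈ (trans (Equivalence.from (inc l) (here refl)) (cong just (sym e₀-src))) l∈)

      right-e₀ : rightInput e₀ ≡ r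
      right-e₀ with binary _ _ _ _ _ inc _ _ ← binary-node X kind-eq =
        sym (right-only e₀∈ (trans (Equivalence.from (inc r) (there (here refl))) (cong just (sym e₀-src))) r∈)

      Contracted : Wire → Set
      Contracted e = e ∈ exits × kind (src e) ≡ contraction

      contracted-label : ∀ {e w} → Contracted e → tgt w ≡ just (src e) → label w ≡ label e
      contracted-label {e} {w} (e∈ , k) eq
        with contraction _ _ c _ inc out p q ← subst (WellFormed src tgt label (src e)) k (wellFormed (src e))
        with here refl ← Equivalence.to (out e) refl with Equivalence.to (inc w) eq
      ... | here refl         = p
      ... | there (here refl) = q

      module _ {T₁ T₂ : Circuit} (i₁ : Part preCircuit Q₁ (Circuit.preCircuit T₁)) (i₂ : Part preCircuit Q₂ (Circuit.preCircuit T₂)) where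

        private
          module T₁ = Circuit T₁
          module T₂ = Circuit T₂
          module i₁ = Part i₁
          module i₂ = Part i₂
        i : Part preCircuit (_∉ finals) (T₁.preCircuit ⊎ᴾ T₂.preCircuit)
        i = part-⊎ X separated y₁∉ y₂∉ covered {T₁} {T₂} i₁ i₂
        open Part i using (wire; wire-injective)

        implements-contraction : ∀ {e w u} → Contracted e → i₁.wire w ≡ leftInput e → i₂.wire u ≡ rightInput e →
                                 Implements X i e (contraction (inj₁ w) (inj₂ u))
        implements-contraction {e} {w} {u} c@(e∈ , k) w≡ u≡ = record
          { exit        = Equivalence.to (exits-complete e) e∈
          ; only-output = output-only e∈
          ; kind-≡      = k
          ; input⁺      = input⁺
          ; input⁻      = input⁻
          ; label-≡     = trans (sym (contracted-label c (input⁺ (here refl)))) (i₁.label-≡ w)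
          }
          where
          input⁺ : ∀ {x} → x ∈ inj₁ w ∷ inj₂ u ∷ [] → tgt (wire x) ≡ just (src e)
          input⁺ (here refl)         = trans (cong tgt w≡) (proj₁ (proj₁ (input-spec e∈)))
          input⁺ (there (here refl)) = trans (cong tgt u≡) (proj₁ (proj₂ (input-spec e∈)))
          input⁻ : ∀ {x} → tgt (wire x) ≡ just (src e) → x ∈ inj₁ w ∷ inj₂ u ∷ []
          input⁻ eq with input-cases e∈ eq
          ... | inj₁ p = here (wire-injective (trans p (sym w≡)))
          ... | inj₂ p = there (here (wire-injective (trans p (sym u≡))))

        recognise : ∀ es → All Contracted es →
                    map i₁.wire T₁.exits ≡ map leftInput es ++ l ∷ [] → map i₂.wire T₂.exits ≡ map rightInput es ++ r ∷ [] →
                    ∀ ws a eqX us b eqY same → X ∼ WithCircuit.circuit T₁ T₂ ws a eqX us b eqY same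
        recognise es contracted eq₁ eq₂ ws a eqX us b eqY same = reassemble
          where
          module W = WithCircuit T₁ T₂ ws a eqX us b eqY same
          split₁ : map i₁.wire ws ≡ map leftInput es × i₁.wire a ≡ l
          split₁ = ∷ʳ-injective _ _ (trans (sym (map-++ i₁.wire ws _)) (trans (cong (map i₁.wire) (sym eqX)) eq₁))
          split₂ : map i₂.wire us ≡ map rightInput es × i₂.wire b ≡ r
          split₂ = ∷ʳ-injective _ _ (trans (sym (map-++ i₂.wire us _)) (trans (cong (map i₂.wire) (sym eqY)) eq₂))
          Implemented : NewNode (T₁.Wire ⊎ T₂.Wire) → Set
          Implemented n = ∃[ e ] e ∈ exits × Implements X i e n
          implemented : ∀ {es} ws us → All Contracted es → map i₁.wire ws ≡ map leftInput es → map i₂.wire us ≡ map rightInput es →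
                        All Implemented (W.contractions ws us ++ binary with′ (inj₁ a) (inj₂ b) ∷ [])
          implemented []       []       []       _ _ =
            (e₀ , e₀∈ , implements-binary X i (trans kind-eq (cong₂ (binary with′) (sym (proj₂ split₁)) (sym (proj₂ split₂)))) f) ∷ []
          implemented (w ∷ ws) (u ∷ us) (c ∷ cs) p q =
            (_ , proj₁ c , implements-contraction c (∷-injectiveˡ p) (∷-injectiveˡ q))
            ∷ implemented ws us cs (∷-injectiveʳ p) (∷-injectiveʳ q)
          implementation : ∀ k → Implemented (lookup W.new k)
          implementation k = All.lookup (implemented ws us contracted (proj₁ split₁) (proj₁ split₂)) (∈-lookup k)
          out-onto : ∀ {v} → v ∈ finals → ∃[ k ] src (proj₁ (implementation k)) ≡ v
          -- The position belonging to `e` is found from its left input: this is an exit of `T₁`, so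
          -- by `split` some new node consumes it, and the node of `X` in that role is its target
          -- `src e`.
          out-onto v∈ with e , e∈ , refl ← ∈-map⁻ src v∈ with (eq , c) , _ ← input-spec e∈
            with w , w∈ , w≡ ← ∈-map⁻ i₁.wire (∈-image-exits X Q₁ i₁ c eq (λ c → ConnectedWithout-∉ X y₁∉ c (∈-map⁺ src e∈)))
            with k , p ← W.A.⊆ins W.new (∈-resp-↭ W.split (∈-++⁺ˡ (∈-map⁺ inj₁ w∈)))
            = k , just-injective (trans (sym (Implements.input⁺ (proj₂ (proj₂ (implementation k))) p)) (trans (cong tgt (sym w≡)) eq))
          open Reassemble X finals (T₁.preCircuit ⊎ᴾ T₂.preCircuit) i W.new (W.consistent ws us same) [] W.split W.order ↭-refl
            (λ k → proj₁ (implementation k)) (λ k → proj₂ (proj₂ (implementation k)))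
            (λ k → ∈-map⁺ src (proj₁ (proj₂ (implementation k)))) out-onto

      -- The `with′` rule wants literally the same context twice. The labels of the left inputs
      -- serve for both premises, because the inputs of a contraction have equal labels.
      conclude : ∀ {es} → All Contracted es →
                 Arranged X Q₁ (map (label ∘ leftInput) es ++ label l ∷ []) (map leftInput es ++ l ∷ []) →
                 Arranged X Q₂ (map (label ∘ leftInput) es ++ label r ∷ []) (map rightInput es ++ r ∷ []) → Sequential X
      conclude {es} contracted (π , i₁ , eq₁) (ρ , i₂ , eq₂) =
        let ws , a , eqX , p , _ = last (translate π) (conclusion-translate π)
            us , b , eqY , q , _ = last (translate ρ) (conclusion-translate ρ)
        in _ , with′ (map (label ∘ leftInput) es) π ρ ,
           recognise {translate π} {translate ρ} i₁ i₂ es contracted eq₁ eq₂ ws a eqX us b eqY (trans p (sym q))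

      moveInputs : (∃[ es ] exits ↭ es ++ e₀ ∷ []) → SequentialAt X finals y₁ → SequentialAt X finals y₂ → Sequential X
      moveInputs (es , σ) (Γ , π , i₁) (Δ , ρ , i₂) = conclude contracted
        (arrange X Q₁ π i₁
          (↭-trans (image-exits y₁∉ leftInput (proj₁ ∘ input-spec) left-only output-only i₁)
            (↭-trans (map⁺ leftInput σ) (↭-reflexive (trans (map-++ leftInput es _) (cong (λ w → map leftInput es ++ w ∷ []) left-e₀)))))
          (trans (map-++ label (map leftInput es) _) (cong (_++ label l ∷ []) (sym (map-∘ es)))))
        (arrange X Q₂ ρ i₂
          (↭-trans (image-exits y₂∉ rightInput (proj₂ ∘ input-spec) right-only output-only i₂)
            (↭-trans (map⁺ rightInput σ) (↭-reflexive (trans (map-++ rightInput es _) (cong (λ w → map rightInput es ++ w ∷ []) right-e₀)))))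
          (trans (map-++ label (map rightInput es) _)
            (cong (_++ label r ∷ []) (trans (sym (map-∘ es)) (map-cong-local (All.map same-label contracted))))))
        where
        contracted : All Contracted es
        -- An exit in `es` differs from `e₀` by uniqueness, and `N` has no other outgoing wire, so
        -- its source is another final node.
        contracted = All.tabulate λ {e} e∈ →
          let e∈′ = ∈-resp-↭ (↭-sym σ) (∈-++⁺ˡ e∈)
          in e∈′ , others (src e) (final e∈′) λ eq →
            Unique-++-disjoint es (Unique-resp-↭ σ exits-unique) e∈ (here (output-only e₀∈ (trans eq (sym e₀-src))))
        same-label : ∀ {e} → Contracted e → label (rightInput e) ≡ label (leftInput e)
        same-label c@(e∈ , _) = trans (contracted-label c (proj₁ (proj₂ (input-spec e∈))))
                                      (sym (contracted-label c (proj₁ (proj₁ (input-spec e∈)))))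

    sequential-ready : ∀ {N} (ready : Ready N) → (∀ {v} → v ∉ deleted ready → SequentialAt X (deleted ready) v) → Sequential X
    sequential-ready (plus s f k)                        at = sequential-plus X f k at
    sequential-ready (tensor l r f k x₁ x₂ components)   at = sequential-tensor X f k components at
    sequential-ready (par l r f k x components)          at = sequential-par X f k components at
    sequential-ready (axiom f k only)                    at = sequential-axiom X k only
    sequential-ready {N} (with′ l r f k others x₁ x₂ components inputs-separated) at
      with x₁∉ ∷ x₂∉ ∷ [] ← Components.surviving components
         | (separated ∷ []) ∷ _ ← Components.distinct components
         | w₁ , w₂ , p₁ , p₂ , c₁ , c₂ ← inputs-separated N f
         | binary _ _ _ _ _ inc _ _ ← binary-node X k
      = orient (Equivalence.to (inc w₁) p₁) (Equivalence.to (inc w₂) p₂)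
      where
      covered : ∀ {v} → v ∉ finals → ConnectedWithout finals x₁ v ⊎ ConnectedWithout finals x₂ v
      covered v∉ with Components.covering components _ v∉
      ... | here c         = inj₁ c
      ... | there (here c) = inj₂ c
      -- The left input of N may lie in either of the two components.
      orient : w₁ ∈ l ∷ r ∷ [] → w₂ ∈ l ∷ r ∷ [] → Sequential X
      orient (here refl)         (there (here refl)) =
        sequential-with f k others separated x₁∉ x₂∉ covered inputs-separated c₁ c₂ (at x₁∉) (at x₂∉)
      orient (there (here refl)) (here refl)         =
        sequential-with f k others (separated ∘ symmetric _) x₂∉ x₁∉ (Sum.swap ∘ covered)
          (λ M fM → let u₁ , u₂ , q₁ , q₂ , d₁ , d₂ = inputs-separated M fM in u₂ , u₁ , q₂ , q₁ , d₂ , d₁)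
          c₂ c₁ (at x₂∉) (at x₁∉)
      orient (here refl)         (here refl)         = contradiction (c₁ ◅◅ symmetric _ c₂) separated
      orient (there (here refl)) (there (here refl)) = contradiction (c₁ ◅◅ symmetric _ c₂) separated

  -- The equivalence

  Reducible⇒Sequential       : ∀ {X} → Reducible X → Sequential X
  -- Spelled out instead of mapped, so that the recursion into the subtrees is visibly structural.
  AllReducible⇒AllSequential : ∀ {S} → All Reducible S → All Sequential S

  Reducible⇒Sequential {X} (reduce s rs) = sequential-ready X ready λ v∉ →
    sequentialAt X (Erasure.Components.covering components _ v∉) residuals (AllReducible⇒AllSequential rs)
    where open _⤳[_]_ s

  AllReducible⇒AllSequential []       = []
  AllReducible⇒AllSequential (r ∷ rs) = Reducible⇒Sequential r ∷ AllReducible⇒AllSequential rs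

  Erasable⇒Sequentializable : ∀ {X} → Erasable X → Sequentializable X
  Erasable⇒Sequentializable steps =
    let _ , π , i = Reducible⇒Sequential (All.head (⤳*-Reducible steps)) in ∼⇒Sequentializable π i

  Sequentializable⇒Erasable : ∀ {X} → Sequentializable X → Erasable X
  Sequentializable⇒Erasable {X} (_ , π , i) =
    Reducible⇒Erasable (translate-reducible π (∼-sym {translate π} {X} (≅⇒∼ i)))

  translate-erasable : ∀ {Γ} (π : ⊢ Γ) → Erasable (translate π)
  translate-erasable π = Reducible⇒Erasable (translate-reducible π (∼-refl (translate π)))

mainTheorem4 : (L : Literals) → let open MALL L in
    ((X : Circuit) → Erasable X ⇔ Sequentializable X) ×
    (∀ {Γ} (π : ⊢ Γ) → Erasable (translate π))
mainTheorem4 L = (λ X → mk⇔ (Erasable⇒Sequentializable L) (Sequentializable⇒Erasable L)) , translate-erasable L
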